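{- Let $p$ be a fixed odd prime. For every $\epsilon>0$ there exists $c>0$ such that for every $n$, if $f:\mathbb{F}_p^n\to[-1,1]$ satisfies $\|f\|_{U^2}\le c$, $a\in[-1,1]$ is a constant, and $g(x)=a+f(x)$ for every $x\in\mathbb{F}_p^n$, then $\bigl|\|g\|_{U^3}^8-(a^8+\|f\|_{U^3}^8)\bigr|\le\epsilon$.
   Context: For real-valued $f$ on $\mathbb{F}_p^n$ and $k\ge2$, $\|f\|_{U^k}^{2^k}=\mathbb{E}_{x,h_1,\dots,h_k\in\mathbb{F}_p^n}\prod_{\omega\in\{0,1\}^k}f(x+\omega_1h_1+\dots+\omega_kh_k)$ (uniform averages). -}

module Defs where

open import Data.Bool.Base using (Bool; true; false; if_then_else_)
open import Data.Fin.Base using (Fin; toℕ)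
open import Data.Integer.Base as ℤ using (+_)
open import Data.List.Base as List using (List; []; _∷_; length; foldr; allFin; cartesianProduct; cartesianProductWith)
open import Data.Nat.Base as ℕ using (ℕ; zero; suc)
open import Data.Nat.DivMod using (_mod_)
import Data.Nat.Properties as ℕₚ
import Data.Nat.Coprimality as Coprime
import Data.Integer.Properties as ℤₚ
import Data.Rational.Unnormalised.Base as ℚᵘ
import Data.Rational.Unnormalised.Properties as ℚᵘₚ
open import Data.Product using (∃-syntax; _×_; _,_; proj₁; proj₂)
open import Data.Rational.Base as ℚ using (ℚ; 0ℚ; 1ℚ; ½)
import Data.Rational.Properties as ℚₚ
open import Data.Rational.Solver using (module +-*-Solver)
open import Data.Sum.Base using (inj₁; inj₂)
open import Data.Vec.Base as Vec using (Vec; []; _∷_)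
open import Relation.Binary.PropositionalEquality using (_≡_; refl; sym; trans; cong; cong₂; subst; subst₂)
open import Relation.Nullary using (Dec; yes; no; contradiction)
open import Relation.Nullary.Decidable using (⌊_⌋)

private
  open +-*-Solver using (solve; con; _:=_; _:+_; _:*_; _:-_; :-_)

  ∣∣-≤ : ∀ {u e} → u ℚ.≤ e → ℚ.- u ℚ.≤ e → ℚ.∣ u ∣ ℚ.≤ e
  ∣∣-≤ {u} u≤e -u≤e with ℚₚ.∣p∣≡p∨∣p∣≡-p u
  ... | inj₁ eq = subst (ℚ._≤ _) (sym eq) u≤e
  ... | inj₂ eq = subst (ℚ._≤ _) (sym eq) -u≤e

  ≤-∣∣ : ∀ u → u ℚ.≤ ℚ.∣ u ∣
  ≤-∣∣ u with ℚₚ.≤-total 0ℚ u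
  ... | inj₁ 0≤u = ℚₚ.≤-reflexive (sym (ℚₚ.0≤p⇒∣p∣≡p 0≤u))
  ... | inj₂ u≤0 = ℚₚ.≤-trans u≤0 (ℚₚ.0≤∣p∣ u)

  ∣-∣-sym : ∀ a b → ℚ.∣ a ℚ.- b ∣ ≡ ℚ.∣ b ℚ.- a ∣
  ∣-∣-sym a b = trans (sym (ℚₚ.∣-p∣≡∣p∣ (a ℚ.- b)))
    (cong ℚ.∣_∣ (solve 2 (λ a b → :- (a :- b) := b :- a) refl a b))

  ≤-shift : ∀ {a b e} → a ℚ.- b ℚ.≤ e → a ℚ.≤ b ℚ.+ e
  ≤-shift {a} {b} {e} h = subst (ℚ._≤ b ℚ.+ e)
    (solve 2 (λ a b → b :+ (a :- b) := a) refl a b) (ℚₚ.+-monoʳ-≤ b h)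

  ≤-unshift : ∀ {a b e} → a ℚ.≤ b ℚ.+ e → a ℚ.- b ℚ.≤ e
  ≤-unshift {a} {b} {e} h = subst (a ℚ.- b ℚ.≤_)
    (solve 2 (λ b e → b :+ e :- b := e) refl b e) (ℚₚ.+-monoˡ-≤ (ℚ.- b) h)

  close : ∀ {a b e} → a ℚ.≤ b ℚ.+ e → b ℚ.≤ a ℚ.+ e → ℚ.∣ a ℚ.- b ∣ ℚ.≤ e
  close {a} {b} p q = ∣∣-≤ (≤-unshift p)
    (subst (ℚ._≤ _) (solve 2 (λ a b → b :- a := :- (a :- b)) refl a b) (≤-unshift q))

  close⁻ : ∀ {a b e} → ℚ.∣ a ℚ.- b ∣ ℚ.≤ e → a ℚ.≤ b ℚ.+ e
  close⁻ {a} {b} h = ≤-shift (ℚₚ.≤-trans (≤-∣∣ (a ℚ.- b)) h)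

  tri : ∀ a b → ℚ.∣ a ∣ ℚ.≤ ℚ.∣ b ∣ ℚ.+ ℚ.∣ a ℚ.- b ∣
  tri a b = subst (λ t → ℚ.∣ t ∣ ℚ.≤ ℚ.∣ b ∣ ℚ.+ ℚ.∣ a ℚ.- b ∣)
    (solve 2 (λ a b → b :+ (a :- b) := a) refl a b) (ℚₚ.∣p+q∣≤∣p∣+∣q∣ b (a ℚ.- b))

  ∣∣-contract : ∀ a b → ℚ.∣ ℚ.∣ a ∣ ℚ.- ℚ.∣ b ∣ ∣ ℚ.≤ ℚ.∣ a ℚ.- b ∣
  ∣∣-contract a b = close (tri a b)
    (subst (λ t → ℚ.∣ b ∣ ℚ.≤ ℚ.∣ a ∣ ℚ.+ t) (∣-∣-sym b a) (tri b a))

  half : ∀ e → ½ ℚ.* e ℚ.+ ½ ℚ.* e ≡ e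
  half e = solve 1 (λ e → con ½ :* e :+ con ½ :* e := e) refl e

  0<½* : ∀ {e} → 0ℚ ℚ.< e → 0ℚ ℚ.< ½ ℚ.* e
  0<½* {e} 0<e = subst (ℚ._< ½ ℚ.* e) (ℚₚ.*-zeroʳ ½) (ℚₚ.*-monoʳ-<-pos ½ 0<e)

  0<+ : ∀ {a} → 0ℚ ℚ.≤ a → 0ℚ ℚ.< 1ℚ ℚ.+ a
  0<+ {a} 0≤a = subst (ℚ._< 1ℚ ℚ.+ a) (ℚₚ.+-identityʳ 0ℚ)
    (ℚₚ.+-mono-<-≤ (ℚₚ.positive⁻¹ 1ℚ) 0≤a)

  quot : ∀ {e k} → 0ℚ ℚ.< e → 0ℚ ℚ.< k → ∃[ d ] 0ℚ ℚ.< d × k ℚ.* d ≡ e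
  quot {e} {k} 0<e 0<k = e ℚ.* 1/k , pos , eq
    where
    instance
      kpos = ℚ.positive 0<k
      knz  = ℚₚ.pos⇒nonZero k
      epos = ℚ.positive 0<e
    1/k = ℚ.1/ k
    instance
      ipos : ℚ.Positive (ℚ.1/ k)
      ipos = ℚₚ.1/pos⇒pos k
    pos = ℚₚ.positive⁻¹ (e ℚ.* 1/k) {{ℚₚ.pos*pos⇒pos e 1/k}}
    eq : k ℚ.* (e ℚ.* 1/k) ≡ e
    eq = trans (solve 3 (λ k e i → k :* (e :* i) := e :* (k :* i)) refl k e 1/k)
      (trans (cong (e ℚ.*_) (ℚₚ.*-inverseʳ k)) (ℚₚ.*-identityʳ e))

  *-≤ : ∀ {a b c d} → 0ℚ ℚ.≤ b → 0ℚ ℚ.≤ c → a ℚ.≤ c → b ℚ.≤ d → a ℚ.* b ℚ.≤ c ℚ.* d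
  *-≤ {a} {b} {c} {d} 0≤b 0≤c a≤c b≤d = ℚₚ.≤-trans
    (ℚₚ.*-monoʳ-≤-nonNeg b {{ℚ.nonNegative 0≤b}} a≤c)
    (ℚₚ.*-monoˡ-≤-nonNeg c {{ℚ.nonNegative 0≤c}} b≤d)

  prod-close : ∀ {a b c d K L δ} →
    ℚ.∣ a ∣ ℚ.≤ K → ℚ.∣ d ∣ ℚ.≤ L → ℚ.∣ a ℚ.- c ∣ ℚ.≤ δ → ℚ.∣ b ℚ.- d ∣ ℚ.≤ δ →
    ℚ.∣ a ℚ.* b ℚ.- c ℚ.* d ∣ ℚ.≤ (K ℚ.+ L) ℚ.* δ
  prod-close {a} {b} {c} {d} {K} {L} {δ} aK dL ac bd =
    subst₂ ℚ._≤_
      (cong ℚ.∣_∣ (solve 4 (λ a b c d → a :* (b :- d) :+ d :* (a :- c) := a :* b :- c :* d) refl a b c d))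
      (solve 3 (λ K L δ → K :* δ :+ L :* δ := (K :+ L) :* δ) refl K L δ)
      (ℚₚ.≤-trans (ℚₚ.∣p+q∣≤∣p∣+∣q∣ (a ℚ.* (b ℚ.- d)) (d ℚ.* (a ℚ.- c)))
        (ℚₚ.+-mono-≤ (bound a (b ℚ.- d) aK bd) (bound d (a ℚ.- c) dL ac)))
    where
    bound : ∀ u v {s t} → ℚ.∣ u ∣ ℚ.≤ s → ℚ.∣ v ∣ ℚ.≤ t → ℚ.∣ u ℚ.* v ∣ ℚ.≤ s ℚ.* t
    bound u v us vt = subst (ℚ._≤ _) (sym (ℚₚ.∣p*q∣≡∣p∣*∣q∣ u v))
      (*-≤ (ℚₚ.0≤∣p∣ v) (ℚₚ.≤-trans (ℚₚ.0≤∣p∣ u) us) us vt)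

infixr 8 _^ℚ_
_^ℚ_ : ℚ → ℕ → ℚ
q ^ℚ zero  = 1ℚ
q ^ℚ suc d = q ℚ.* q ^ℚ d

private
  0≤^ : ∀ {q} d → 0ℚ ℚ.≤ q → 0ℚ ℚ.≤ q ^ℚ d
  0≤^ zero    0≤q = ℚₚ.nonNegative⁻¹ 1ℚ
  0≤^ {q} (suc d) 0≤q = subst (ℚ._≤ q ℚ.* q ^ℚ d) (ℚₚ.*-zeroʳ 0ℚ)
    (*-≤ ℚₚ.≤-refl 0≤q 0≤q (0≤^ d 0≤q))

  0<^ : ∀ {q} d → 0ℚ ℚ.< q → 0ℚ ℚ.< q ^ℚ d
  0<^ zero    0<q = ℚₚ.positive⁻¹ 1ℚ
  0<^ {q} (suc d) 0<q = ℚₚ.positive⁻¹ (q ℚ.* q ^ℚ d)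
    {{ℚₚ.pos*pos⇒pos q {{ℚ.positive 0<q}} (q ^ℚ d) {{ℚ.positive (0<^ d 0<q)}}}}

  ^-mono : ∀ {u v} d → 0ℚ ℚ.≤ u → u ℚ.≤ v → u ^ℚ d ℚ.≤ v ^ℚ d
  ^-mono zero    0≤u u≤v = ℚₚ.≤-refl
  ^-mono (suc d) 0≤u u≤v = *-≤ (0≤^ d 0≤u) (ℚₚ.≤-trans 0≤u u≤v) u≤v (^-mono d 0≤u u≤v)

  ^-super : ∀ {v e} d → 0ℚ ℚ.≤ v → 0ℚ ℚ.≤ e →
    v ^ℚ suc d ℚ.+ e ^ℚ suc d ℚ.≤ (v ℚ.+ e) ^ℚ suc d
  ^-super {v} {e} d 0≤v 0≤e = subst (v ^ℚ suc d ℚ.+ e ^ℚ suc d ℚ.≤_)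
    (sym (ℚₚ.*-distribʳ-+ ((v ℚ.+ e) ^ℚ d) v e))
    (ℚₚ.+-mono-≤
      (*-≤ (0≤^ d 0≤v) 0≤v ℚₚ.≤-refl (^-mono d 0≤v v≤))
      (*-≤ (0≤^ d 0≤e) 0≤e ℚₚ.≤-refl (^-mono d 0≤e e≤)))
    where
    v≤ = subst (ℚ._≤ v ℚ.+ e) (ℚₚ.+-identityʳ v) (ℚₚ.+-monoʳ-≤ v 0≤e)
    e≤ = subst (ℚ._≤ v ℚ.+ e) (ℚₚ.+-identityˡ e) (ℚₚ.+-monoˡ-≤ e 0≤v)

Eventually : (ℕ → Set) → Set
Eventually P = ∃[ N ] (∀ n → N ℕ.≤ n → P n)

Cauchy : (ℕ → ℚ) → Set
Cauchy s = ∀ ε → 0ℚ ℚ.< ε → ∃[ N ] (∀ m n → N ℕ.≤ m → N ℕ.≤ n → ℚ.∣ s m ℚ.- s n ∣ ℚ.≤ ε)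

-- Reals are Cauchy sequences of rationals; equality of reals is _≈_, not _≡_.
record ℝ : Set where
  constructor mkℝ
  field
    seq    : ℕ → ℚ
    cauchy : Cauchy seq
open ℝ public

infix 4 _≈_ _≤_ _<_

_≈_ : ℝ → ℝ → Set
x ≈ y = ∀ ε → 0ℚ ℚ.< ε → Eventually (λ n → ℚ.∣ seq x n ℚ.- seq y n ∣ ℚ.≤ ε)

_≤_ : ℝ → ℝ → Set
x ≤ y = ∀ ε → 0ℚ ℚ.< ε → Eventually (λ n → seq x n ℚ.≤ seq y n ℚ.+ ε)

_<_ : ℝ → ℝ → Set
x < y = ∃[ δ ] 0ℚ ℚ.< δ × Eventually (λ n → seq x n ℚ.+ δ ℚ.≤ seq y n)

private
  infixr 4 _&_
  _&_ : ∀ {P Q} → Eventually P → Eventually Q → Eventually (λ n → P n × Q n)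
  (M , f) & (N , g) = M ℕ.⊔ N , λ n h →
    f n (ℕₚ.≤-trans (ℕₚ.m≤m⊔n M N) h) , g n (ℕₚ.≤-trans (ℕₚ.m≤n⊔m M N) h)

  bounded : ∀ {s} → Cauchy s → ∃[ K ] 0ℚ ℚ.< K × Eventually (λ n → ℚ.∣ s n ∣ ℚ.≤ K)
  bounded {s} c with c 1ℚ (ℚₚ.positive⁻¹ 1ℚ)
  ... | N , h = 1ℚ ℚ.+ ℚ.∣ s N ∣ , 0<+ (ℚₚ.0≤∣p∣ (s N)) , N , λ n N≤n →
    ℚₚ.≤-trans (tri (s n) (s N))
      (subst (ℚ.∣ s N ∣ ℚ.+ ℚ.∣ s n ℚ.- s N ∣ ℚ.≤_) (ℚₚ.+-comm ℚ.∣ s N ∣ 1ℚ)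
        (ℚₚ.+-monoʳ-≤ ℚ.∣ s N ∣ (h n N N≤n ℕₚ.≤-refl)))

  0<+′ : ∀ {a b} → 0ℚ ℚ.< a → 0ℚ ℚ.< b → 0ℚ ℚ.< a ℚ.+ b
  0<+′ {a} {b} 0<a 0<b = subst (ℚ._< a ℚ.+ b) (ℚₚ.+-identityʳ 0ℚ) (ℚₚ.+-mono-< 0<a 0<b)

  const-cauchy : ∀ q → Cauchy (λ _ → q)
  const-cauchy q ε 0<ε = 0 , λ _ _ _ _ →
    subst (λ t → ℚ.∣ t ∣ ℚ.≤ ε) (sym (ℚₚ.+-inverseʳ q)) (ℚₚ.<⇒≤ 0<ε)

  +-cauchy : ∀ {s t} → Cauchy s → Cauchy t → Cauchy (λ n → s n ℚ.+ t n)
  +-cauchy {s} {t} cs ct ε 0<ε with cs (½ ℚ.* ε) (0<½* 0<ε) | ct (½ ℚ.* ε) (0<½* 0<ε)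
  ... | M , f | N , g = M ℕ.⊔ N , λ m n hm hn →
    subst₂ ℚ._≤_
      (cong ℚ.∣_∣ (solve 4 (λ a b c d → (a :- c) :+ (b :- d) := (a :+ b) :- (c :+ d)) refl (s m) (t m) (s n) (t n)))
      (half ε)
      (ℚₚ.≤-trans (ℚₚ.∣p+q∣≤∣p∣+∣q∣ (s m ℚ.- s n) (t m ℚ.- t n))
        (ℚₚ.+-mono-≤
          (f m n (ℕₚ.≤-trans (ℕₚ.m≤m⊔n M N) hm) (ℕₚ.≤-trans (ℕₚ.m≤m⊔n M N) hn))
          (g m n (ℕₚ.≤-trans (ℕₚ.m≤n⊔m M N) hm) (ℕₚ.≤-trans (ℕₚ.m≤n⊔m M N) hn))))

  neg-cauchy : ∀ {s} → Cauchy s → Cauchy (λ n → ℚ.- s n)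
  neg-cauchy {s} cs ε 0<ε with cs ε 0<ε
  ... | N , f = N , λ m n hm hn → subst (ℚ._≤ ε)
    (trans (sym (ℚₚ.∣-p∣≡∣p∣ (s m ℚ.- s n)))
      (cong ℚ.∣_∣ (solve 2 (λ a b → :- (a :- b) := :- a :- :- b) refl (s m) (s n))))
    (f m n hm hn)

  ∣∣-cauchy : ∀ {s} → Cauchy s → Cauchy (λ n → ℚ.∣ s n ∣)
  ∣∣-cauchy {s} cs ε 0<ε with cs ε 0<ε
  ... | N , f = N , λ m n hm hn → ℚₚ.≤-trans (∣∣-contract (s m) (s n)) (f m n hm hn)

  *-cauchy : ∀ {s t} → Cauchy s → Cauchy t → Cauchy (λ n → s n ℚ.* t n)
  *-cauchy {s} {t} cs ct ε 0<ε = go (bounded {s} cs) (bounded {t} ct)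
    where
    Bounded : (ℕ → ℚ) → Set
    Bounded u = ∃[ K ] 0ℚ ℚ.< K × Eventually (λ n → ℚ.∣ u n ∣ ℚ.≤ K)
    go : Bounded s → Bounded t →
      ∃[ N ] (∀ m n → N ℕ.≤ m → N ℕ.≤ n → ℚ.∣ s m ℚ.* t m ℚ.- s n ℚ.* t n ∣ ℚ.≤ ε)
    go (K , 0<K , A , bs) (L , 0<L , B , bt) =
      (A ℕ.⊔ B) ℕ.⊔ (M ℕ.⊔ N) , λ m n hm hn →
        ℚₚ.≤-trans
          (prod-close
            (bs m (≤ˡ A B (≤ˡ (A ℕ.⊔ B) (M ℕ.⊔ N) hm))) (bt n (≤ʳ A B (≤ˡ (A ℕ.⊔ B) (M ℕ.⊔ N) hn)))
            (proj₂ s-close m n (≤ˡ M N (≤ʳ (A ℕ.⊔ B) (M ℕ.⊔ N) hm)) (≤ˡ M N (≤ʳ (A ℕ.⊔ B) (M ℕ.⊔ N) hn)))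
            (proj₂ t-close m n (≤ʳ M N (≤ʳ (A ℕ.⊔ B) (M ℕ.⊔ N) hm)) (≤ʳ M N (≤ʳ (A ℕ.⊔ B) (M ℕ.⊔ N) hn))))
          (ℚₚ.≤-reflexive (proj₂ (proj₂ δ)))
      where
      δ = quot 0<ε (0<+′ 0<K 0<L)
      s-close = cs (proj₁ δ) (proj₁ (proj₂ δ))
      t-close = ct (proj₁ δ) (proj₁ (proj₂ δ))
      M = proj₁ s-close
      N = proj₁ t-close
      ≤ˡ : ∀ i j {k} → i ℕ.⊔ j ℕ.≤ k → i ℕ.≤ k
      ≤ˡ i j = ℕₚ.≤-trans (ℕₚ.m≤m⊔n i j)
      ≤ʳ : ∀ i j {k} → i ℕ.⊔ j ℕ.≤ k → j ℕ.≤ k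
      ≤ʳ i j = ℕₚ.≤-trans (ℕₚ.m≤n⊔m i j)

fromℚ : ℚ → ℝ
fromℚ q = mkℝ (λ _ → q) (const-cauchy q)

0ℝ 1ℝ : ℝ
0ℝ = fromℚ 0ℚ
1ℝ = fromℚ 1ℚ

infix  8 -_
infixl 7 _*_
infixl 6 _+_ _-_
infixr 8 _^_

_+_ : ℝ → ℝ → ℝ
x + y = mkℝ (λ n → seq x n ℚ.+ seq y n) (+-cauchy {seq x} {seq y} (cauchy x) (cauchy y))

-_ : ℝ → ℝ
- x = mkℝ (λ n → ℚ.- seq x n) (neg-cauchy {seq x} (cauchy x))

_-_ : ℝ → ℝ → ℝ
x - y = x + (- y)

_*_ : ℝ → ℝ → ℝ
x * y = mkℝ (λ n → seq x n ℚ.* seq y n) (*-cauchy {seq x} {seq y} (cauchy x) (cauchy y))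

∣_∣ : ℝ → ℝ
∣ x ∣ = mkℝ (λ n → ℚ.∣ seq x n ∣) (∣∣-cauchy {seq x} (cauchy x))

_^_ : ℝ → ℕ → ℝ
x ^ zero  = 1ℝ
x ^ suc d = x * x ^ d

midpoint : ℚ → ℚ → ℚ
midpoint a b = ½ ℚ.* (a ℚ.+ b)

-- The interval left after m bisection steps on [lo , hi] in search of the d-th
-- root of q.
bisect : ℕ → ℚ → ℕ → ℚ → ℚ → ℚ × ℚ
bisect d q zero    lo hi = lo , hi
bisect d q (suc m) lo hi =
  if ⌊ midpoint lo hi ^ℚ d ℚₚ.≤? q ⌋
    then bisect d q m (midpoint lo hi) hi
    else bisect d q m lo (midpoint lo hi)

rootInterval : ℕ → ℚ → ℕ → ℚ × ℚ
rootInterval d q m = bisect d q m 0ℚ (1ℚ ℚ.+ ℚ.∣ q ∣)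

private
  record Inv (B : ℚ) (d : ℕ) (q lo hi : ℚ) : Set where
    field
      0≤lo  : 0ℚ ℚ.≤ lo
      lo≤hi : lo ℚ.≤ hi
      low   : lo ^ℚ d ℚ.≤ 0ℚ ℚ.⊔ q
      high  : 0ℚ ℚ.⊔ q ℚ.≤ hi ^ℚ d
      top   : hi ℚ.≤ B
  open Inv

  mid-≥ : ∀ {lo hi} → lo ℚ.≤ hi → lo ℚ.≤ midpoint lo hi
  mid-≥ {lo} {hi} h = subst (ℚ._≤ ½ ℚ.* (lo ℚ.+ hi))
    (solve 1 (λ l → con ½ :* (l :+ l) := l) refl lo)
    (ℚₚ.*-monoˡ-≤-nonNeg ½ (ℚₚ.+-monoʳ-≤ lo h))

  mid-≤ : ∀ {lo hi} → lo ℚ.≤ hi → midpoint lo hi ℚ.≤ hi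
  mid-≤ {lo} {hi} h = subst (½ ℚ.* (lo ℚ.+ hi) ℚ.≤_)
    (solve 1 (λ l → con ½ :* (l :+ l) := l) refl hi)
    (ℚₚ.*-monoˡ-≤-nonNeg ½ (ℚₚ.+-monoˡ-≤ hi h))

  width-r : ∀ h l t → t ℚ.* (h ℚ.- midpoint l h) ≡ (½ ℚ.* t) ℚ.* (h ℚ.- l)
  width-r = solve 3 (λ h l t → t :* (h :- con ½ :* (l :+ h)) := (con ½ :* t) :* (h :- l)) refl

  width-l : ∀ h l t → t ℚ.* (midpoint l h ℚ.- l) ≡ (½ ℚ.* t) ℚ.* (h ℚ.- l)
  width-l = solve 3 (λ h l t → t :* (con ½ :* (l :+ h) :- l) := (con ½ :* t) :* (h :- l)) refl

  BisectInv : ℚ → ℕ → ℚ → ℕ → ℚ → ℚ → ℚ × ℚ → Set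
  BisectInv B d q m lo hi r =
    Inv B d q (proj₁ r) (proj₂ r) × proj₂ r ℚ.- proj₁ r ≡ ½ ^ℚ m ℚ.* (hi ℚ.- lo)

  bisect-inv : ∀ {B} d q m lo hi → Inv B d q lo hi → BisectInv B d q m lo hi (bisect d q m lo hi)
  bisect-inv d q zero lo hi I = I , sym (ℚₚ.*-identityˡ (hi ℚ.- lo))
  bisect-inv {B} d q (suc m) lo hi I = step (c ^ℚ d ℚₚ.≤? q)
    where
    c = midpoint lo hi
    0≤c : 0ℚ ℚ.≤ c
    0≤c = ℚₚ.≤-trans (0≤lo I) (mid-≥ (lo≤hi I))
    step : (D : Dec (c ^ℚ d ℚ.≤ q)) → BisectInv B d q (suc m) lo hi
      (if ⌊ D ⌋ then bisect d q m c hi else bisect d q m lo c)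
    step (yes p) = proj₁ J , trans (proj₂ J) (width-r hi lo (½ ^ℚ m))
      where
      J = bisect-inv d q m c hi (record
        { 0≤lo  = 0≤c
        ; lo≤hi = mid-≤ (lo≤hi I)
        ; low   = ℚₚ.≤-trans p (ℚₚ.p≤q⊔p 0ℚ q)
        ; high  = high I
        ; top   = top I })
    step (no ¬p) = proj₁ J , trans (proj₂ J) (width-l hi lo (½ ^ℚ m))
      where
      J = bisect-inv d q m lo c (record
        { 0≤lo  = 0≤lo I
        ; lo≤hi = mid-≥ (lo≤hi I)
        ; low   = low I
        ; high  = ℚₚ.⊔-lub (0≤^ d 0≤c) (ℚₚ.<⇒≤ (ℚₚ.≰⇒> ¬p))
        ; top   = ℚₚ.≤-trans (mid-≤ (lo≤hi I)) (top I) })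

  start : ∀ d q → Inv (1ℚ ℚ.+ ℚ.∣ q ∣) (suc d) q 0ℚ (1ℚ ℚ.+ ℚ.∣ q ∣)
  start d q = record
    { 0≤lo  = ℚₚ.≤-refl
    ; lo≤hi = 0≤B
    ; low   = subst (ℚ._≤ 0ℚ ℚ.⊔ q) (sym (ℚₚ.*-zeroˡ (0ℚ ^ℚ d))) (ℚₚ.p≤p⊔q 0ℚ q)
    ; high  = ℚₚ.⊔-lub (0≤^ (suc d) 0≤B) (ℚₚ.≤-trans q≤B B≤B^)
    ; top   = ℚₚ.≤-refl
    }
    where
    B = 1ℚ ℚ.+ ℚ.∣ q ∣
    0≤B : 0ℚ ℚ.≤ B
    0≤B = ℚₚ.<⇒≤ (0<+ (ℚₚ.0≤∣p∣ q))
    1≤B : 1ℚ ℚ.≤ B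
    1≤B = subst (ℚ._≤ B) (ℚₚ.+-identityʳ 1ℚ) (ℚₚ.+-monoʳ-≤ 1ℚ (ℚₚ.0≤∣p∣ q))
    q≤B : q ℚ.≤ B
    q≤B = ℚₚ.≤-trans (≤-∣∣ q) (subst (ℚ._≤ B) (ℚₚ.+-identityˡ ℚ.∣ q ∣)
      (ℚₚ.+-monoˡ-≤ ℚ.∣ q ∣ (ℚₚ.nonNegative⁻¹ 1ℚ)))
    1^ : ∀ d → 1ℚ ^ℚ d ≡ 1ℚ
    1^ zero    = refl
    1^ (suc d) = trans (ℚₚ.*-identityˡ (1ℚ ^ℚ d)) (1^ d)
    B≤B^ : B ℚ.≤ B ℚ.* B ^ℚ d
    B≤B^ = subst (ℚ._≤ B ℚ.* B ^ℚ d) (ℚₚ.*-identityʳ B)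
      (ℚₚ.*-monoˡ-≤-nonNeg B {{ℚ.nonNegative 0≤B}}
        (subst (ℚ._≤ B ^ℚ d) (1^ d) (^-mono d (ℚₚ.nonNegative⁻¹ 1ℚ) 1≤B)))

  nat : ℕ → ℚ
  nat n = ℚ.mkℚ (+ n) 0 (Coprime.sym (Coprime.1-coprimeTo n))

  nat-suc : ∀ n → nat (suc n) ≡ 1ℚ ℚ.+ nat n
  nat-suc n = ℚₚ.toℚᵘ-injective (ℚᵘₚ.≃-trans
    (ℚᵘ.*≡* (cong (ℤ._* + 1) (sym (cong₂ ℤ._+_ (ℤₚ.*-identityʳ (+ 1)) (ℤₚ.*-identityʳ (+ n))))))
    (ℚᵘₚ.≃-sym (ℚₚ.toℚᵘ-homo-+ 1ℚ (nat n))))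

  archimedean : ∀ {δ} → 0ℚ ℚ.< δ → ∃[ n ] 1ℚ ℚ.≤ nat (suc n) ℚ.* δ
  archimedean {δ@(ℚ.mkℚ (+ zero) _ _)} 0<δ = contradiction (ℚₚ.drop-*<* 0<δ) (ℤₚ.<-irrefl refl)
  archimedean {δ@(ℚ.mkℚ (ℤ.-[1+ _ ]) _ _)} 0<δ = contradiction (ℚₚ.drop-*<* 0<δ) λ ()
  archimedean {δ@(ℚ.mkℚ (+ suc a) b _)} 0<δ = b , ℚₚ.toℚᵘ-cancel-≤
    (ℚᵘₚ.≤-trans
      (ℚᵘ.*≤* (ℤ.+≤+ (subst₂ ℕ._≤_
        (sym (ℕₚ.*-identityˡ _)) (sym (ℕₚ.*-identityʳ _))
        (subst (ℕ._≤ suc b ℕ.* suc a) (sym (ℕₚ.+-identityʳ (suc b))) (ℕₚ.m≤m*n (suc b) (suc a))))))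
      (ℚᵘₚ.≤-reflexive (ℚᵘₚ.≃-sym (ℚₚ.toℚᵘ-homo-* (nat (suc b)) δ))))

  0≤½^ : ∀ n → 0ℚ ℚ.≤ ½ ^ℚ n
  0≤½^ n = 0≤^ n (ℚₚ.nonNegative⁻¹ ½)

  ½^-suc : ∀ n → ½ ^ℚ suc n ℚ.≤ ½ ^ℚ n
  ½^-suc n = subst (½ ^ℚ suc n ℚ.≤_) (ℚₚ.*-identityˡ (½ ^ℚ n))
    (ℚₚ.*-monoʳ-≤-nonNeg (½ ^ℚ n) {{ℚ.nonNegative (0≤½^ n)}} {½} {1ℚ} (ℚ.*≤* (ℤ.+≤+ (ℕ.s≤s ℕ.z≤n))))

  ½^-≤1 : ∀ n → ½ ^ℚ n ℚ.≤ 1ℚ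
  ½^-≤1 zero    = ℚₚ.≤-refl
  ½^-≤1 (suc n) = ℚₚ.≤-trans (½^-suc n) (½^-≤1 n)

  ½^-anti : ∀ {m n} → m ℕ.≤′ n → ½ ^ℚ n ℚ.≤ ½ ^ℚ m
  ½^-anti (ℕ.≤′-reflexive refl) = ℚₚ.≤-refl
  ½^-anti {n = suc n} (ℕ.≤′-step h) = ℚₚ.≤-trans (½^-suc n) (½^-anti h)

  ½^-decay : ∀ n → nat n ℚ.* ½ ^ℚ n ℚ.≤ 1ℚ
  ½^-decay zero    = subst (ℚ._≤ 1ℚ) (sym (ℚₚ.*-zeroˡ 1ℚ)) (ℚₚ.nonNegative⁻¹ 1ℚ)
  ½^-decay (suc n) = subst (ℚ._≤ 1ℚ) (trans (lem (nat n) (½ ^ℚ n)) (cong (ℚ._* (½ ℚ.* ½ ^ℚ n)) (sym (nat-suc n))))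
    (ℚₚ.*-monoˡ-≤-nonNeg ½ (ℚₚ.+-mono-≤ (½^-≤1 n) (½^-decay n)))
    where
    lem : ∀ k t → ½ ℚ.* (t ℚ.+ k ℚ.* t) ≡ (1ℚ ℚ.+ k) ℚ.* (½ ℚ.* t)
    lem = solve 2 (λ k t → con ½ :* (t :+ k :* t) := (con 1ℚ :+ k) :* (con ½ :* t)) refl

  ½^-small : ∀ {δ} → 0ℚ ℚ.< δ → Eventually (λ n → ½ ^ℚ n ℚ.≤ δ)
  ½^-small {δ} 0<δ with archimedean 0<δ
  ... | b , 1≤ = suc b , λ n h → ℚₚ.≤-trans (½^-anti (ℕₚ.≤⇒≤′ h))
    (ℚₚ.*-cancelˡ-≤-pos (nat (suc b)) (ℚₚ.≤-trans (½^-decay (suc b)) 1≤))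

  module Root (d : ℕ) (s : ℕ → ℚ) (cs : Cauchy s) where
    lo hi : ℕ → ℚ
    lo n = proj₁ (rootInterval (suc d) (s n) n)
    hi n = proj₂ (rootInterval (suc d) (s n) n)

    inv : ∀ n → BisectInv (1ℚ ℚ.+ ℚ.∣ s n ∣) (suc d) (s n) n 0ℚ (1ℚ ℚ.+ ℚ.∣ s n ∣) (rootInterval (suc d) (s n) n)
    inv n = bisect-inv (suc d) (s n) n 0ℚ (1ℚ ℚ.+ ℚ.∣ s n ∣) (start d (s n))

    narrow : ∀ {δ} → 0ℚ ℚ.< δ → Eventually (λ n → hi n ℚ.- lo n ℚ.≤ δ)
    narrow {δ} 0<δ = go (bounded {s} cs)
      where
      go : (∃[ K ] 0ℚ ℚ.< K × Eventually (λ n → ℚ.∣ s n ∣ ℚ.≤ K)) → Eventually (λ n → hi n ℚ.- lo n ℚ.≤ δ)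
      go (K , 0<K , b) = proj₁ both , λ n h → subst₂ ℚ._≤_ (sym (proj₂ (inv n)))
          (trans (ℚₚ.*-comm (proj₁ η) (1ℚ ℚ.+ K)) (proj₂ (proj₂ η)))
          (*-≤ (0≤w n) (ℚₚ.<⇒≤ (proj₁ (proj₂ η))) (proj₂ (proj₂ both n h))
            (subst (ℚ._≤ 1ℚ ℚ.+ K) (sym (ℚₚ.+-identityʳ _)) (ℚₚ.+-monoʳ-≤ 1ℚ (proj₁ (proj₂ both n h)))))
        where
        η = quot 0<δ (0<+ (ℚₚ.<⇒≤ 0<K))
        both = b & ½^-small (proj₁ (proj₂ η))
        0≤w : ∀ n → 0ℚ ℚ.≤ (1ℚ ℚ.+ ℚ.∣ s n ∣) ℚ.- 0ℚ
        0≤w n = subst (0ℚ ℚ.≤_) (sym (ℚₚ.+-identityʳ _)) (ℚₚ.<⇒≤ (0<+ (ℚₚ.0≤∣p∣ (s n))))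

    lo-close : ∀ {e m n} → 0ℚ ℚ.< e → hi n ℚ.- lo n ℚ.≤ e →
      s m ℚ.≤ s n ℚ.+ ½ ℚ.* e ^ℚ suc d → lo m ℚ.≤ lo n ℚ.+ (e ℚ.+ e)
    lo-close {e} {m} {n} 0<e w h with lo m ℚₚ.≤? hi n ℚ.+ e
    ... | yes p = ℚₚ.≤-trans p (subst (hi n ℚ.+ e ℚ.≤_) (ℚₚ.+-assoc (lo n) e e)
      (ℚₚ.+-monoˡ-≤ e (≤-shift {hi n} {lo n} w)))
    ... | no ¬p = contradiction (ℚₚ.≤-<-trans chain (ℚₚ.+-monoʳ-< (hi n ^ℚ suc d) η<)) (ℚₚ.<-irrefl refl)
      where
      η = ½ ℚ.* e ^ℚ suc d
      0<η : 0ℚ ℚ.< η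
      0<η = 0<½* (0<^ (suc d) 0<e)
      η< : η ℚ.< e ^ℚ suc d
      η< = subst₂ ℚ._<_ (ℚₚ.+-identityʳ η) (half (e ^ℚ suc d)) (ℚₚ.+-monoʳ-< η 0<η)
      0≤hi = ℚₚ.≤-trans (0≤lo (proj₁ (inv n))) (lo≤hi (proj₁ (inv n)))
      0≤hi+e : 0ℚ ℚ.≤ hi n ℚ.+ e
      0≤hi+e = subst (ℚ._≤ hi n ℚ.+ e) (ℚₚ.+-identityʳ 0ℚ) (ℚₚ.+-mono-≤ 0≤hi (ℚₚ.<⇒≤ 0<e))
      s⁺ : 0ℚ ℚ.⊔ s m ℚ.≤ (0ℚ ℚ.⊔ s n) ℚ.+ η
      s⁺ = ℚₚ.⊔-lub
        (subst (ℚ._≤ (0ℚ ℚ.⊔ s n) ℚ.+ η) (ℚₚ.+-identityʳ 0ℚ) (ℚₚ.+-mono-≤ (ℚₚ.p≤p⊔q 0ℚ (s n)) (ℚₚ.<⇒≤ 0<η)))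
        (ℚₚ.≤-trans h (ℚₚ.+-monoˡ-≤ η (ℚₚ.p≤q⊔p 0ℚ (s n))))
      chain : hi n ^ℚ suc d ℚ.+ e ^ℚ suc d ℚ.≤ hi n ^ℚ suc d ℚ.+ η
      chain = ℚₚ.≤-trans (^-super d 0≤hi (ℚₚ.<⇒≤ 0<e))
        (ℚₚ.≤-trans (^-mono (suc d) 0≤hi+e (ℚₚ.<⇒≤ (ℚₚ.≰⇒> ¬p)))
        (ℚₚ.≤-trans (low (proj₁ (inv m)))
        (ℚₚ.≤-trans s⁺ (ℚₚ.+-monoˡ-≤ η (high (proj₁ (inv n)))))))

    lo-cauchy : Cauchy lo
    lo-cauchy ε 0<ε = go (narrow 0<e) (cs (½ ℚ.* e ^ℚ suc d) (0<½* (0<^ (suc d) 0<e)))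
      where
      e = ½ ℚ.* ε
      0<e = 0<½* 0<ε
      go : Eventually (λ n → hi n ℚ.- lo n ℚ.≤ e) →
        ∃[ N ] (∀ m n → N ℕ.≤ m → N ℕ.≤ n → ℚ.∣ s m ℚ.- s n ∣ ℚ.≤ ½ ℚ.* e ^ℚ suc d) →
        ∃[ N ] (∀ m n → N ℕ.≤ m → N ℕ.≤ n → ℚ.∣ lo m ℚ.- lo n ∣ ℚ.≤ ε)
      go (M , f) (N , g) = M ℕ.⊔ N , λ m n hm hn → close (side m n hm hn) (side n m hn hm)
        where
        side : ∀ m n → M ℕ.⊔ N ℕ.≤ m → M ℕ.⊔ N ℕ.≤ n → lo m ℚ.≤ lo n ℚ.+ ε
        side m n hm hn = subst (λ t → lo m ℚ.≤ lo n ℚ.+ t) (half ε)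
          (lo-close {e} {m} {n} 0<e (f n (ℕₚ.≤-trans (ℕₚ.m≤m⊔n M N) hn))
            (close⁻ (g m n (ℕₚ.≤-trans (ℕₚ.m≤n⊔m M N) hm) (ℕₚ.≤-trans (ℕₚ.m≤n⊔m M N) hn))))

-- The d-th root of the positive part of x; by 0≤root and root-^ below, it is
-- the nonnegative d-th root of x whenever 0 ≤ x.
root : (d : ℕ) → .{{ℕ.NonZero d}} → ℝ → ℝ
root (suc d) x = mkℝ (λ n → proj₁ (rootInterval (suc d) (seq x n) n)) (Root.lo-cauchy d (seq x) (cauchy x))

private
  seq-^ : ∀ x d n → seq (x ^ d) n ≡ seq x n ^ℚ d
  seq-^ x zero    n = refl
  seq-^ x (suc d) n = cong (seq x n ℚ.*_) (seq-^ x d n)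

  lipschitz : ∀ {K} d → 0ℚ ℚ.≤ K → ∃[ C ] 0ℚ ℚ.≤ C ×
    (∀ {l h} → 0ℚ ℚ.≤ l → l ℚ.≤ h → h ℚ.≤ K → h ^ℚ d ℚ.≤ l ^ℚ d ℚ.+ C ℚ.* (h ℚ.- l))
  lipschitz {K} zero 0≤K = 0ℚ , ℚₚ.≤-refl , λ {l} {h} _ _ _ →
    ℚₚ.≤-reflexive (sym (trans (cong (1ℚ ℚ.+_) (ℚₚ.*-zeroˡ (h ℚ.- l))) (ℚₚ.+-identityʳ 1ℚ)))
  lipschitz {K} (suc d) 0≤K = go (lipschitz {K} d 0≤K)
    where
    P : ℕ → Set
    P d = ∃[ C ] 0ℚ ℚ.≤ C ×
      (∀ {l h} → 0ℚ ℚ.≤ l → l ℚ.≤ h → h ℚ.≤ K → h ^ℚ d ℚ.≤ l ^ℚ d ℚ.+ C ℚ.* (h ℚ.- l))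
    go : P d → P (suc d)
    go (C , 0≤C , IH) = K ^ℚ d ℚ.+ K ℚ.* C ,
      subst (ℚ._≤ K ^ℚ d ℚ.+ K ℚ.* C) (ℚₚ.+-identityʳ 0ℚ) (ℚₚ.+-mono-≤ (0≤^ d 0≤K) 0≤KC) ,
      λ {l} {h} 0≤l l≤h h≤K →
        let 0≤h = ℚₚ.≤-trans 0≤l l≤h
            0≤w = subst (ℚ._≤ h ℚ.- l) (ℚₚ.+-inverseʳ l) (ℚₚ.+-monoˡ-≤ (ℚ.- l) l≤h)
        in ℚₚ.≤-trans
          (ℚₚ.*-monoˡ-≤-nonNeg h {{ℚ.nonNegative 0≤h}} (IH 0≤l l≤h h≤K))
          (subst (ℚ._≤ l ^ℚ suc d ℚ.+ (K ^ℚ d ℚ.+ K ℚ.* C) ℚ.* (h ℚ.- l)) (sym (rearrange h l (l ^ℚ d) C))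
            (ℚₚ.+-monoʳ-≤ (l ^ℚ suc d)
              (ℚₚ.*-monoʳ-≤-nonNeg (h ℚ.- l) {{ℚ.nonNegative 0≤w}}
                (ℚₚ.+-mono-≤ (^-mono d 0≤l (ℚₚ.≤-trans l≤h h≤K))
                  (ℚₚ.*-monoʳ-≤-nonNeg C {{ℚ.nonNegative 0≤C}} h≤K)))))
      where
      0≤KC : 0ℚ ℚ.≤ K ℚ.* C
      0≤KC = subst (ℚ._≤ K ℚ.* C) (ℚₚ.*-zeroʳ 0ℚ) (*-≤ ℚₚ.≤-refl 0≤K 0≤K 0≤C)
      rearrange : ∀ h l t C → h ℚ.* (t ℚ.+ C ℚ.* (h ℚ.- l)) ≡ l ℚ.* t ℚ.+ (t ℚ.+ h ℚ.* C) ℚ.* (h ℚ.- l)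
      rearrange = solve 4 (λ h l t C → h :* (t :+ C :* (h :- l)) := l :* t :+ (t :+ h :* C) :* (h :- l)) refl

0≤root : ∀ d .{{_ : ℕ.NonZero d}} x → 0ℝ ≤ root d x
0≤root (suc d) x ε 0<ε = 0 , λ n _ →
  subst (ℚ._≤ Root.lo d (seq x) (cauchy x) n ℚ.+ ε) (ℚₚ.+-identityʳ 0ℚ)
    (ℚₚ.+-mono-≤ (0≤lo (proj₁ (Root.inv d (seq x) (cauchy x) n))) (ℚₚ.<⇒≤ 0<ε))

root-^ : ∀ d .{{_ : ℕ.NonZero d}} x → 0ℝ ≤ x → root d x ^ d ≈ x
root-^ (suc d) x 0≤x ε 0<ε = go (bounded {seq x} (cauchy x))
  where
  open Root d (seq x) (cauchy x)
  s = seq x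
  go : (∃[ K ] 0ℚ ℚ.< K × Eventually (λ n → ℚ.∣ s n ∣ ℚ.≤ K)) →
    Eventually (λ n → ℚ.∣ seq (root (suc d) x ^ suc d) n ℚ.- s n ∣ ℚ.≤ ε)
  go (K , 0<K , b) = proj₁ all , λ n h →
    subst (λ t → ℚ.∣ t ℚ.- s n ∣ ℚ.≤ ε) (sym (seq-^ (root (suc d) x) (suc d) n))
      (conclude n (proj₁ (proj₂ all n h)) (proj₁ (proj₂ (proj₂ all n h))) (proj₂ (proj₂ (proj₂ all n h))))
    where
    lip = lipschitz {1ℚ ℚ.+ K} (suc d) (ℚₚ.<⇒≤ (0<+ (ℚₚ.<⇒≤ 0<K)))
    C = proj₁ lip
    0<1+C = 0<+ (proj₁ (proj₂ lip))
    η = quot 0<ε 0<1+C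
    δ = proj₁ η
    all = b & narrow {δ} (proj₁ (proj₂ η)) & 0≤x ε 0<ε

    conclude : ∀ n → ℚ.∣ s n ∣ ℚ.≤ K → hi n ℚ.- lo n ℚ.≤ δ → 0ℚ ℚ.≤ s n ℚ.+ ε →
      ℚ.∣ lo n ^ℚ suc d ℚ.- s n ∣ ℚ.≤ ε
    conclude n bn w 0≤s+ε = close
      (ℚₚ.≤-trans (low I) (ℚₚ.⊔-lub 0≤s+ε s≤s+ε))
      (ℚₚ.≤-trans (ℚₚ.p≤q⊔p 0ℚ (s n)) (ℚₚ.≤-trans (high I)
        (ℚₚ.≤-trans (proj₂ (proj₂ lip) (0≤lo I) (lo≤hi I) hi≤) (ℚₚ.+-monoʳ-≤ (lo n ^ℚ suc d) Cw≤))))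
      where
      I = proj₁ (inv n)
      hi≤ : hi n ℚ.≤ 1ℚ ℚ.+ K
      hi≤ = ℚₚ.≤-trans (top I) (ℚₚ.+-monoʳ-≤ 1ℚ bn)
      s≤s+ε : s n ℚ.≤ s n ℚ.+ ε
      s≤s+ε = subst (ℚ._≤ s n ℚ.+ ε) (ℚₚ.+-identityʳ (s n)) (ℚₚ.+-monoʳ-≤ (s n) (ℚₚ.<⇒≤ 0<ε))
      0≤w : 0ℚ ℚ.≤ hi n ℚ.- lo n
      0≤w = subst (ℚ._≤ hi n ℚ.- lo n) (ℚₚ.+-inverseʳ (lo n)) (ℚₚ.+-monoˡ-≤ (ℚ.- lo n) (lo≤hi I))
      C≤1+C : C ℚ.≤ 1ℚ ℚ.+ C
      C≤1+C = subst (ℚ._≤ 1ℚ ℚ.+ C) (ℚₚ.+-identityˡ C) (ℚₚ.+-monoˡ-≤ C (ℚₚ.nonNegative⁻¹ 1ℚ))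
      Cw≤ : C ℚ.* (hi n ℚ.- lo n) ℚ.≤ ε
      Cw≤ = subst (C ℚ.* (hi n ℚ.- lo n) ℚ.≤_) (proj₂ (proj₂ η))
        (*-≤ 0≤w (ℚₚ.<⇒≤ 0<1+C) C≤1+C w)

∑ ∏ : {A : Set} → List A → (A → ℝ) → ℝ
∑ xs f = foldr _+_ 0ℝ (List.map f xs)
∏ xs f = foldr _*_ 1ℝ (List.map f xs)

recip : ℕ → ℝ
recip zero      = 0ℝ
recip n@(suc _) = fromℚ (+ 1 ℚ./ n)

-- The uniform average over the entries of a list (0 for the empty list).
𝔼 : {A : Set} → List A → (A → ℝ) → ℝ
𝔼 xs f = recip (length xs) * ∑ xs f

-- All vectors of length k with entries in xs; applied to a repetition-free
-- enumeration of A, this is a repetition-free enumeration of A^k.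
vecs : {A : Set} → List A → (k : ℕ) → List (Vec A k)
vecs xs zero    = [] ∷ []
vecs xs (suc k) = cartesianProductWith _∷_ xs (vecs xs k)

-- The additive group of 𝔽ₚ is Fin p with addition modulo p.
_+ₚ_ : {p : ℕ} → Fin p → Fin p → Fin p
_+ₚ_ {p@(suc _)} i j = (toℕ i ℕ.+ toℕ j) mod p

_⊕_ : {p n : ℕ} → Vec (Fin p) n → Vec (Fin p) n → Vec (Fin p) n
_⊕_ = Vec.zipWith _+ₚ_

points : (p n : ℕ) → List (Vec (Fin p) n)
points p n = vecs (allFin p) n

-- vertex x h ω is x + ω₁h₁ + … + ωₖhₖ.
vertex : {p n k : ℕ} → Vec (Fin p) n → Vec (Vec (Fin p) n) k → Vec Bool k → Vec (Fin p) n
vertex x []       []          = x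
vertex x (h ∷ hs) (true ∷ ω)  = vertex (x ⊕ h) hs ω
vertex x (h ∷ hs) (false ∷ ω) = vertex x hs ω

-- ‖f‖_{Uᵏ} raised to the power 2ᵏ.
gowersPower : {p n : ℕ} → ℕ → (Vec (Fin p) n → ℝ) → ℝ
gowersPower {p} {n} k f =
  𝔼 (cartesianProduct (points p n) (vecs (points p n) k)) λ (x , h) →
    ∏ (vecs (false ∷ true ∷ []) k) λ ω → f (vertex x h ω)

-- gowersPower k f is nonnegative for k ≥ 1, so root extracts its genuine root.
‖_‖U : {p n : ℕ} → (Vec (Fin p) n → ℝ) → ℕ → ℝ
‖ f ‖U k = root (2 ℕ.^ k) {{ℕₚ.m^n≢0 2 k}} (gowersPower k f)

{-# OPTIONS --safe #-}
module Submission where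

-- Expanding g = a + f in the Gowers U³ form one vertex of the cube at a time,
-- starting from a fixed vertex and always moving to a neighbour of a vertex
-- already treated, every discarded term carries f at one end of some edge of
-- the cube and the constant a at the other.  With the step along that edge
-- fixed, such a term is a U² box form in which one of the four functions is
-- a translate of f times a; two applications of Cauchy–Schwarz bound it by a
-- constant times ‖f‖_{U²}.  Reals are sequences of rationals with pointwise
-- operations, so the estimate is proved for rational-valued functions and
-- applied at every index; eventually the functions are bounded by 2.

open import Algebra.Properties.CommutativeMonoid.Sum using (sum; sum-permute)
open import Data.Bool.Base using (Bool; true; false; not)
open import Data.Fin.Base using (Fin; toℕ)
open import Data.List.Base as List using (List; []; _∷_; _++_; length; allFin; tabulate; cartesianProduct; cartesianProductWith)
open import Data.Nat.Base as ℕ using (ℕ; zero; suc)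
open import Data.Nat.Divisibility using (_∤_)
open import Data.Nat.DivMod using (_mod_; _%_; m%n<n; m%n%n≡m%n; %-distribˡ-+; m<n⇒m%n≡m; n%n≡0)
open import Data.Nat.Primality using (Prime; ¬prime[0])
open import Data.Product using (∃-syntax; _×_; _,_; proj₁; proj₂)
open import Data.Rational.Base using (ℚ; 0ℚ; 1ℚ; ½; nonNegative)
open import Data.Rational.Solver using (module +-*-Solver)
open import Data.Sum.Base using (inj₁; inj₂)
open import Data.Unit.Base using (⊤; tt)
open import Data.Vec.Base using (Vec; []; _∷_)
open import Function.Base using (_∘_; id)
open import Relation.Binary.PropositionalEquality using (_≡_; refl; sym; trans; cong; cong₂; subst; subst₂; module ≡-Reasoning)
open import Relation.Nullary using (yes; no; contradiction)
import Data.Fin.Permutation as Perm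
import Data.Fin.Properties as Finₚ
import Data.Integer.Base as ℤ
import Data.Integer.Properties as ℤₚ
import Data.List.Properties as Listₚ
import Data.Nat.Properties as ℕₚ
import Data.Rational.Base as ℚ
import Data.Rational.Properties as ℚₚ
import Data.Rational.Unnormalised.Base as ℚᵘ
import Data.Rational.Unnormalised.Properties as ℚᵘₚ
import Data.Vec.Properties as Vecₚ
open import Defs using (_^ℚ_; _+ₚ_; _⊕_; points; vecs; vertex)

open +-*-Solver using (solve; con; _:=_; _:+_; _:*_; _:-_; :-_)

-- Order, absolute values and squares in the rationals.

module RationalLemmas where
  open import Data.Rational.Base using (_+_; _*_; _-_; -_; ∣_∣; _≤_; _<_)

  *-mono-≤ : ∀ {a b c d} → 0ℚ ≤ b → 0ℚ ≤ c → a ≤ c → b ≤ d → a * b ≤ c * d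
  *-mono-≤ {b = b} {c} 0≤b 0≤c a≤c b≤d = ℚₚ.≤-trans
    (ℚₚ.*-monoʳ-≤-nonNeg b {{nonNegative 0≤b}} a≤c)
    (ℚₚ.*-monoˡ-≤-nonNeg c {{nonNegative 0≤c}} b≤d)

  0≤* : ∀ {a b} → 0ℚ ≤ a → 0ℚ ≤ b → 0ℚ ≤ a * b
  0≤* {a} {b} 0≤a 0≤b = subst (_≤ a * b) (ℚₚ.*-zeroʳ 0ℚ) (*-mono-≤ ℚₚ.≤-refl 0≤a 0≤a 0≤b)

  0≤+ : ∀ {a b} → 0ℚ ≤ a → 0ℚ ≤ b → 0ℚ ≤ a + b
  0≤+ {a} {b} 0≤a 0≤b = subst (_≤ a + b) (ℚₚ.+-identityʳ 0ℚ) (ℚₚ.+-mono-≤ 0≤a 0≤b)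

  ∣∣-square : ∀ u → ∣ u ∣ * ∣ u ∣ ≡ u * u
  ∣∣-square u with ℚₚ.∣p∣≡p∨∣p∣≡-p u
  ... | inj₁ eq = cong₂ _*_ eq eq
  ... | inj₂ eq = trans (cong₂ _*_ eq eq) (solve 1 (λ u → :- u :* :- u := u :* u) refl u)

  0≤square : ∀ u → 0ℚ ≤ u * u
  0≤square u = subst (0ℚ ≤_) (∣∣-square u) (0≤* (ℚₚ.0≤∣p∣ u) (ℚₚ.0≤∣p∣ u))

  ∣∣≤⇒≤ : ∀ {u m} → ∣ u ∣ ≤ m → u ≤ m
  ∣∣≤⇒≤ {u} h with ℚₚ.≤-total 0ℚ u
  ... | inj₁ 0≤u = subst (_≤ _) (ℚₚ.0≤p⇒∣p∣≡p 0≤u) h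
  ... | inj₂ u≤0 = ℚₚ.≤-trans u≤0 (ℚₚ.≤-trans (ℚₚ.0≤∣p∣ u) h)

  ∣∣≤⇒-≤ : ∀ {u m} → ∣ u ∣ ≤ m → - m ≤ u
  ∣∣≤⇒-≤ {u} h = subst (_ ≤_) (solve 1 (λ u → :- :- u := u) refl u)
    (ℚₚ.neg-antimono-≤ (∣∣≤⇒≤ (subst (_≤ _) (sym (ℚₚ.∣-p∣≡∣p∣ u)) h)))

  ≤⇒∣∣≤ : ∀ {u m} → - m ≤ u → u ≤ m → ∣ u ∣ ≤ m
  ≤⇒∣∣≤ {u} {m} l h with ℚₚ.∣p∣≡p∨∣p∣≡-p u
  ... | inj₁ eq = subst (_≤ m) (sym eq) h
  ... | inj₂ eq = subst₂ _≤_ (sym eq) (solve 1 (λ u → :- :- u := u) refl m) (ℚₚ.neg-antimono-≤ l)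

  ∣*∣≤ : ∀ {u v s t} → ∣ u ∣ ≤ s → ∣ v ∣ ≤ t → ∣ u * v ∣ ≤ s * t
  ∣*∣≤ {u} {v} us vt = subst (_≤ _) (sym (ℚₚ.∣p*q∣≡∣p∣*∣q∣ u v))
    (*-mono-≤ (ℚₚ.0≤∣p∣ v) (ℚₚ.≤-trans (ℚₚ.0≤∣p∣ u) us) us vt)

  ∣+∣≤ : ∀ {u v s t} → ∣ u ∣ ≤ s → ∣ v ∣ ≤ t → ∣ u + v ∣ ≤ s + t
  ∣+∣≤ {u} {v} us vt = ℚₚ.≤-trans (ℚₚ.∣p+q∣≤∣p∣+∣q∣ u v) (ℚₚ.+-mono-≤ us vt)

  ∣-∣-sym : ∀ u v → ∣ u - v ∣ ≡ ∣ v - u ∣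
  ∣-∣-sym u v = trans (sym (ℚₚ.∣-p∣≡∣p∣ (u - v)))
    (cong ∣_∣ (solve 2 (λ u v → :- (u :- v) := v :- u) refl u v))

  ∣-∣-trans : ∀ {u v w s t} → ∣ u - v ∣ ≤ s → ∣ v - w ∣ ≤ t → ∣ u - w ∣ ≤ s + t
  ∣-∣-trans {u} {v} {w} p q = subst (λ z → ∣ z ∣ ≤ _)
    (solve 3 (λ u v w → (u :- v) :+ (v :- w) := u :- w) refl u v w) (∣+∣≤ p q)

  -- Replaces the square root after Cauchy-Schwarz: if |u| exceeded m, then m·m ≤ m·|u| < |u|·|u|,
  -- against the hypothesis.
  square-cancel-≤ : ∀ {u m} → 0ℚ ≤ m → u * u ≤ m * m → ∣ u ∣ ≤ m
  square-cancel-≤ {u} {m} 0≤m h with ∣ u ∣ ℚₚ.≤? m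
  ... | yes p = p
  ... | no ¬p = contradiction (ℚₚ.≤-<-trans h (subst (m * m <_) (∣∣-square u) mm<uu)) (ℚₚ.<-irrefl refl)
    where
    m<u = ℚₚ.≰⇒> ¬p
    mm<uu : m * m < ∣ u ∣ * ∣ u ∣
    mm<uu = ℚₚ.≤-<-trans
      (ℚₚ.*-monoʳ-≤-nonNeg m {{nonNegative 0≤m}} (ℚₚ.<⇒≤ m<u))
      (ℚₚ.*-monoʳ-<-pos ∣ u ∣ {{ℚ.positive (ℚₚ.≤-<-trans 0≤m m<u)}} m<u)

open RationalLemmas

-- Box forms and Cauchy–Schwarz

-- A translation-invariant averaging operator on a commutative semigroup, stated abstractly so that
-- the estimates below never meet the enumeration of the points. `E-swap` is Fubini, and `E-shift`
-- is the only source of changes of variable.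
record Mean (G : Set) (_⊕_ : G → G → G) : Set where
  field
    E       : (G → ℚ) → ℚ
    E-cong  : ∀ {F H} → (∀ x → F x ≡ H x) → E F ≡ E H
    E-+     : ∀ F H → E (λ x → F x ℚ.+ H x) ≡ E F ℚ.+ E H
    E-*     : ∀ c F → E (λ x → c ℚ.* F x) ≡ c ℚ.* E F
    E-mono  : ∀ {F H} → (∀ x → F x ℚ.≤ H x) → E F ℚ.≤ E H
    E-const : ∀ c → E (λ _ → c) ≡ c
    E-swap  : ∀ (F : G → G → ℚ) → E (λ x → E (λ y → F x y)) ≡ E (λ y → E (λ x → F x y))
    E-shift : ∀ F h → E (λ x → F (x ⊕ h)) ≡ E F
    ⊕-assoc : ∀ x y z → (x ⊕ y) ⊕ z ≡ x ⊕ (y ⊕ z)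
    ⊕-comm  : ∀ x y → x ⊕ y ≡ y ⊕ x

-- The outermost node is the direction of h₁, as in vertex.
data Cube (A : Set) : ℕ → Set where
  leaf : A → Cube A 0
  node : ∀ {k} → Cube A k → Cube A k → Cube A (suc k)

constant : {A : Set} → ∀ k → A → Cube A k
constant zero    c = leaf c
constant (suc k) c = node (constant k c) (constant k c)

-- Leaves carry labels interpreted by `ev`, not functions, so a cube mixing a, f and g is finite
-- data whose edges can be matched on.
cubeProduct : {A G : Set} → (G → G → G) → (A → G → ℚ) → ∀ {k} → Cube A k → G → Vec G k → ℚ
cubeProduct _⊕_ ev (leaf c)     x []       = ev c x
cubeProduct _⊕_ ev (node F₀ F₁) x (h ∷ hs) =
  cubeProduct _⊕_ ev F₀ x hs ℚ.* cubeProduct _⊕_ ev F₁ (x ⊕ h) hs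

module MeanTheory {G : Set} {_⊕_ : G → G → G} (mean : Mean G _⊕_) where
  open Mean mean public
  open import Data.Rational.Base using (_+_; _*_; _-_; -_; ∣_∣; _≤_)

  Eᵛ : ∀ k → (Vec G k → ℚ) → ℚ
  Eᵛ zero    F = F []
  Eᵛ (suc k) F = E λ h → Eᵛ k λ hs → F (h ∷ hs)

  Eᵛ-cong : ∀ k {F H} → (∀ x → F x ≡ H x) → Eᵛ k F ≡ Eᵛ k H
  Eᵛ-cong zero    eq = eq []
  Eᵛ-cong (suc k) eq = E-cong λ h → Eᵛ-cong k λ hs → eq (h ∷ hs)

  Eᵛ-+ : ∀ k F H → Eᵛ k (λ x → F x + H x) ≡ Eᵛ k F + Eᵛ k H
  Eᵛ-+ zero    F H = refl
  Eᵛ-+ (suc k) F H = trans (E-cong λ h → Eᵛ-+ k (λ hs → F (h ∷ hs)) (λ hs → H (h ∷ hs))) (E-+ _ _)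

  ⊕-swapʳ : ∀ x y z → (x ⊕ y) ⊕ z ≡ (x ⊕ z) ⊕ y
  ⊕-swapʳ x y z = trans (⊕-assoc x y z) (trans (cong (x ⊕_) (⊕-comm y z)) (sym (⊕-assoc x z y)))

  E-*ʳ : ∀ F c → E (λ x → F x * c) ≡ E F * c
  E-*ʳ F c = trans (E-cong λ x → ℚₚ.*-comm (F x) c) (trans (E-* c F) (ℚₚ.*-comm c (E F)))

  E-product : ∀ F H → E (λ x → E (λ y → F x * H y)) ≡ E F * E H
  E-product F H = trans (E-cong λ x → E-* (F x) H) (E-*ʳ F (E H))

  E-∣∣≤ : ∀ {F m} → (∀ x → ∣ F x ∣ ≤ m) → ∣ E F ∣ ≤ m
  E-∣∣≤ {F} {m} h = ≤⇒∣∣≤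
    (subst (_≤ E F) (E-const (- m)) (E-mono λ x → ∣∣≤⇒-≤ (h x)))
    (subst (E F ≤_) (E-const m) (E-mono λ x → ∣∣≤⇒≤ (h x)))

  E-nonneg : ∀ {F} → (∀ x → 0ℚ ≤ F x) → 0ℚ ≤ E F
  E-nonneg {F} h = subst (_≤ E F) (E-const 0ℚ) (E-mono h)

  E-≤ : ∀ {F m} → (∀ x → F x ≤ m) → E F ≤ m
  E-≤ {F} {m} h = subst (E F ≤_) (E-const m) (E-mono h)

  ⟨_,_⟩ : (G → ℚ) → (G → ℚ) → ℚ
  ⟨ u , v ⟩ = E λ x → u x * v x

  -- Lagrange's identity: averaging the square of `minor x y` over both variables gives twice the
  -- difference of the two sides, and an average of squares is nonnegative.
  cauchy-schwarz : ∀ u v → ⟨ u , v ⟩ * ⟨ u , v ⟩ ≤ ⟨ u , u ⟩ * ⟨ v , v ⟩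
  cauchy-schwarz u v = ℚₚ.*-cancelˡ-≤-pos two (ℚₚ.≤-trans
    (ℚₚ.≤-reflexive (solve 1 (λ c → con two :* c := con 0ℚ :+ con two :* c) refl (⟨ u , v ⟩ * ⟨ u , v ⟩)))
    (subst₂ _≤_ refl total (ℚₚ.+-monoˡ-≤ (two * (⟨ u , v ⟩ * ⟨ u , v ⟩)) 0≤D)))
    where
    two = 1ℚ + 1ℚ
    minor : G → G → ℚ
    minor x y = u x * v y - u y * v x
    D = E λ x → E λ y → minor x y * minor x y
    0≤D : 0ℚ ≤ D
    0≤D = E-nonneg λ x → E-nonneg λ y → 0≤square (minor x y)
    expand : ∀ x y → minor x y * minor x y + two * ((u x * v x) * (u y * v y))
      ≡ (u x * u x) * (v y * v y) + (v x * v x) * (u y * u y)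
    expand x y = solve 4 (λ a b c d → (a :* d :- c :* b) :* (a :* d :- c :* b) :+ con two :* ((a :* b) :* (c :* d))
      := (a :* a) :* (d :* d) :+ (b :* b) :* (c :* c)) refl (u x) (v x) (u y) (v y)
    EE-+ : ∀ (F H : G → G → ℚ) → E (λ x → E λ y → F x y + H x y) ≡ E (λ x → E (F x)) + E (λ x → E (H x))
    EE-+ F H = trans (E-cong λ x → E-+ (F x) (H x)) (E-+ _ _)
    open ≡-Reasoning
    total : D + two * (⟨ u , v ⟩ * ⟨ u , v ⟩) ≡ two * (⟨ u , u ⟩ * ⟨ v , v ⟩)
    total = begin
      D + two * (⟨ u , v ⟩ * ⟨ u , v ⟩)
        ≡⟨ cong (λ z → D + two * z) (sym (E-product _ _)) ⟩
      D + two * E (λ x → E λ y → (u x * v x) * (u y * v y))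
        ≡⟨ cong (D +_) (sym (trans (E-cong λ x → E-* two _) (E-* two _))) ⟩
      D + E (λ x → E λ y → two * ((u x * v x) * (u y * v y)))
        ≡⟨ sym (EE-+ _ _) ⟩
      E (λ x → E λ y → minor x y * minor x y + two * ((u x * v x) * (u y * v y)))
        ≡⟨ (E-cong λ x → E-cong λ y → expand x y) ⟩
      E (λ x → E λ y → (u x * u x) * (v y * v y) + (v x * v x) * (u y * u y))
        ≡⟨ EE-+ _ _ ⟩
      E (λ x → E λ y → (u x * u x) * (v y * v y)) + E (λ x → E λ y → (v x * v x) * (u y * u y))
        ≡⟨ cong₂ _+_ (E-product _ _) (E-product _ _) ⟩
      ⟨ u , u ⟩ * ⟨ v , v ⟩ + ⟨ v , v ⟩ * ⟨ u , u ⟩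
        ≡⟨ solve 2 (λ a b → a :* b :+ b :* a := con two :* (a :* b)) refl ⟨ u , u ⟩ ⟨ v , v ⟩ ⟩
      two * (⟨ u , u ⟩ * ⟨ v , v ⟩) ∎

  corr : (G → ℚ) → (G → ℚ) → G → ℚ
  corr A B h = E λ x → A x * B (x ⊕ h)

  -- The Gowers inner product of order two, with four unrelated functions on the vertices of a
  -- parallelogram.
  box : (A B C D : G → ℚ) → ℚ
  box A B C D = E λ x → E λ h₁ → E λ h₂ → (A x * B (x ⊕ h₂)) * (C (x ⊕ h₁) * D ((x ⊕ h₁) ⊕ h₂))

  box-swap : ∀ A B C D → box A B C D ≡ box A C B D
  box-swap A B C D = E-cong λ x → trans (E-swap _) (E-cong λ h₂ → E-cong λ h₁ →
    trans (cong (λ z → (A x * B (x ⊕ h₂)) * (C (x ⊕ h₁) * D z)) (⊕-swapʳ x h₁ h₂))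
      (solve 4 (λ a b c d → (a :* b) :* (c :* d) := (a :* c) :* (b :* d)) refl (A x) (B (x ⊕ h₂)) (C (x ⊕ h₁)) _))

  -- Once x and h₂ are fixed, x + h₁ ranges uniformly, so C and D contribute `corr C D h₂` whatever
  -- x is; the average over x then produces `corr A B h₂`.
  box-corr : ∀ A B C D → box A B C D ≡ ⟨ corr A B , corr C D ⟩
  box-corr A B C D = begin
    box A B C D
      ≡⟨ (E-cong λ x → E-swap _) ⟩
    E (λ x → E λ h₂ → E λ h₁ → (A x * B (x ⊕ h₂)) * (C (x ⊕ h₁) * D ((x ⊕ h₁) ⊕ h₂)))
      ≡⟨ (E-cong λ x → E-cong λ h₂ → E-* (A x * B (x ⊕ h₂)) λ h₁ → C (x ⊕ h₁) * D ((x ⊕ h₁) ⊕ h₂)) ⟩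
    E (λ x → E λ h₂ → (A x * B (x ⊕ h₂)) * E λ h₁ → C (x ⊕ h₁) * D ((x ⊕ h₁) ⊕ h₂))
      -- Rewriting x + h₁ as h₁ + x turns the average over h₁ into a translate by x.
      ≡⟨ (E-cong λ x → E-cong λ h₂ → cong ((A x * B (x ⊕ h₂)) *_) (trans
           (E-cong λ h₁ → cong (λ z → C z * D (z ⊕ h₂)) (⊕-comm x h₁))
           (E-shift (λ z → C z * D (z ⊕ h₂)) x))) ⟩
    E (λ x → E λ h₂ → (A x * B (x ⊕ h₂)) * corr C D h₂)
      ≡⟨ E-swap _ ⟩
    E (λ h₂ → E λ x → (A x * B (x ⊕ h₂)) * corr C D h₂)
      ≡⟨ (E-cong λ h₂ → E-*ʳ _ _) ⟩
    ⟨ corr A B , corr C D ⟩ ∎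
    where open ≡-Reasoning

  u2 : (G → ℚ) → ℚ
  u2 A = box A A A A

  u2-corr : ∀ A → u2 A ≡ ⟨ corr A A , corr A A ⟩
  u2-corr A = box-corr A A A A

  0≤u2 : ∀ A → 0ℚ ≤ u2 A
  0≤u2 A = subst (0ℚ ≤_) (sym (u2-corr A)) (E-nonneg λ h → 0≤square (corr A A h))

  energy : (G → ℚ) → (G → ℚ) → ℚ
  energy A B = ⟨ corr A B , corr A B ⟩

  -- Exchanging h₁ and h₂ in `box A B A B` pairs A with A and B with B, which separates the two
  -- functions.
  energy-autocorr : ∀ A B → energy A B ≡ ⟨ corr A A , corr B B ⟩
  energy-autocorr A B = trans (sym (box-corr A B A B)) (trans (box-swap A B A B) (box-corr A A B B))

  energy-comm : ∀ A B → energy A B ≡ energy B A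
  energy-comm A B = trans (energy-autocorr A B)
    (trans (E-cong λ h → ℚₚ.*-comm (corr A A h) (corr B B h)) (sym (energy-autocorr B A)))

  -- Together with `box²` these are the two applications of Cauchy-Schwarz: the first reduces a box
  -- form to energies of pairs, the second an energy to the U² forms of single functions.
  energy² : ∀ A B → energy A B * energy A B ≤ u2 A * u2 B
  energy² A B = subst₂ _≤_
    (cong₂ _*_ (sym (energy-autocorr A B)) (sym (energy-autocorr A B)))
    (cong₂ _*_ (sym (u2-corr A)) (sym (u2-corr B)))
    (cauchy-schwarz (corr A A) (corr B B))

  box² : ∀ A B C D → box A B C D * box A B C D ≤ energy A B * energy C D
  box² A B C D = subst (_≤ energy A B * energy C D)
    (cong₂ _*_ (sym (box-corr A B C D)) (sym (box-corr A B C D)))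
    (cauchy-schwarz (corr A B) (corr C D))

  module Bounds {M : ℚ} (0≤M : 0ℚ ≤ M) where

    Bounded : (G → ℚ) → Set
    Bounded A = ∀ x → ∣ A x ∣ ≤ M

    energy-≤ : ∀ {A B} → Bounded A → Bounded B → energy A B ≤ (M * M) * (M * M)
    energy-≤ {A} {B} bA bB = E-≤ λ h → ∣∣≤⇒≤ (∣*∣≤ {corr A B h} {corr A B h} (c h) (c h))
      where
      c : ∀ h → ∣ corr A B h ∣ ≤ M * M
      c h = E-∣∣≤ λ x → ∣*∣≤ {A x} {B (x ⊕ h)} (bA x) (bB (x ⊕ h))

    -- Says that the U² norm of A is at most m for m ≥ 0, with the fourth root cleared.
    Small : ℚ → (G → ℚ) → Set
    Small m A = u2 A ≤ (m * m) * (m * m)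

    -- `energy²` bounds the squared energy by m⁴M⁴, since the U² form of a function bounded by M is
    -- at most M⁴.
    energy-smallˡ : ∀ {m A B} → Small m A → Bounded B → energy A B ≤ (m * M) * (m * M)
    energy-smallˡ {m} {A} {B} sA bB = ∣∣≤⇒≤ (square-cancel-≤ {energy A B} (0≤square (m * M))
      (ℚₚ.≤-trans (energy² A B) (ℚₚ.≤-trans
        (*-mono-≤ (0≤u2 B) (0≤square (m * m)) sA
          (subst (_≤ (M * M) * (M * M)) (sym (u2-corr B)) (energy-≤ bB bB)))
        (ℚₚ.≤-reflexive (solve 2 (λ m M → ((m :* m) :* (m :* m)) :* ((M :* M) :* (M :* M))
          := ((m :* M) :* (m :* M)) :* ((m :* M) :* (m :* M))) refl m M)))))

    energy-smallʳ : ∀ {m A B} → Bounded A → Small m B → energy A B ≤ (m * M) * (m * M)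
    energy-smallʳ {m} {A} {B} bA sB = subst (_≤ (m * M) * (m * M)) (energy-comm B A) (energy-smallˡ {m} {B} {A} sB bA)

    -- The pair A, B has energy at most (mM)² and the pair C, D at most M⁴; their product is the
    -- square of mM³.
    box-smallˡ : ∀ {m A B C D} → 0ℚ ≤ m → energy A B ≤ (m * M) * (m * M) → Bounded C → Bounded D →
      ∣ box A B C D ∣ ≤ m * (M * (M * M))
    box-smallˡ {m} {A} {B} {C} {D} 0≤m e bC bD = square-cancel-≤ {box A B C D} (0≤* 0≤m (0≤* 0≤M (0≤square M)))
      (ℚₚ.≤-trans (box² A B C D) (ℚₚ.≤-trans
        (*-mono-≤ (E-nonneg λ h → 0≤square (corr C D h)) (0≤square (m * M)) e (energy-≤ bC bD))
        (ℚₚ.≤-reflexive (solve 2 (λ m M → ((m :* M) :* (m :* M)) :* ((M :* M) :* (M :* M))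
          := (m :* (M :* (M :* M))) :* (m :* (M :* (M :* M)))) refl m M))))

    box-smallʳ : ∀ {m A B C D} → 0ℚ ≤ m → Bounded A → Bounded B → energy C D ≤ (m * M) * (m * M) →
      ∣ box A B C D ∣ ≤ m * (M * (M * M))
    box-smallʳ {m} {A} {B} {C} {D} 0≤m bA bB e = subst (λ z → ∣ z ∣ ≤ m * (M * (M * M)))
      (trans (box-corr C D A B) (trans (E-cong λ h → ℚₚ.*-comm (corr C D h) (corr A B h)) (sym (box-corr A B C D))))
      (box-smallˡ {m} {C} {D} {A} {B} 0≤m e bA bB)

  -- The U² form sees a function only through its autocorrelation, in which it is quadratic. Hence
  -- translates of `A` multiplied by `a` are covered without comparing `B` with `A` pointwise.
  u2-scale : ∀ a {A B} → (∀ h → corr B B h ≡ (a * a) * corr A A h) → u2 B ≡ ((a * a) * (a * a)) * u2 A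
  u2-scale a {A} {B} eq = begin
    u2 B
      ≡⟨ u2-corr B ⟩
    ⟨ corr B B , corr B B ⟩
      ≡⟨ (E-cong λ h → trans (cong₂ _*_ (eq h) (eq h))
           (solve 2 (λ a c → ((a :* a) :* c) :* ((a :* a) :* c) := ((a :* a) :* (a :* a)) :* (c :* c)) refl a (corr A A h))) ⟩
    E (λ h → ((a * a) * (a * a)) * (corr A A h * corr A A h))
      ≡⟨ E-* ((a * a) * (a * a)) (λ h → corr A A h * corr A A h) ⟩
    ((a * a) * (a * a)) * ⟨ corr A A , corr A A ⟩
      ≡⟨ cong (((a * a) * (a * a)) *_) (sym (u2-corr A)) ⟩
    ((a * a) * (a * a)) * u2 A ∎
    where open ≡-Reasoning

  -- Averages over labelled cubes: symmetry in the directions and multilinearity.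

  module CubeMean {A : Set} (ev : A → G → ℚ) where

    prod : ∀ {k} → Cube A k → G → Vec G k → ℚ
    prod = cubeProduct _⊕_ ev

    Λ : ∀ {k} → Cube A k → ℚ
    Λ {k} F = E λ x → Eᵛ k (prod F x)

    -- The product along one edge with the step h fixed; with equal labels it is the multiplicative
    -- derivative of the function in direction h.
    pair : Cube A 1 → G → G → ℚ
    pair P h x = prod P x (h ∷ [])

    prod-swap : ∀ {k} (P Q R S : Cube A k) x h₁ h₂ hs →
      prod (node (node P Q) (node R S)) x (h₁ ∷ h₂ ∷ hs) ≡ prod (node (node P R) (node Q S)) x (h₂ ∷ h₁ ∷ hs)
    prod-swap P Q R S x h₁ h₂ hs = trans
      (cong (λ z → (prod P x hs * prod Q (x ⊕ h₂) hs) * (prod R (x ⊕ h₁) hs * prod S z hs)) (⊕-swapʳ x h₁ h₂))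
      (solve 4 (λ a b c d → (a :* b) :* (c :* d) := (a :* c) :* (b :* d)) refl
        (prod P x hs) (prod Q (x ⊕ h₂) hs) (prod R (x ⊕ h₁) hs) _)

    Λ-swap₁₂ : (P Q R S : Cube A 1) → Λ (node (node P Q) (node R S)) ≡ Λ (node (node P R) (node Q S))
    Λ-swap₁₂ P Q R S = E-cong λ x → trans (E-swap _)
      (E-cong λ h₂ → E-cong λ h₁ → E-cong λ h₃ → prod-swap P Q R S x h₁ h₂ (h₃ ∷ []))

    Λ-swap₂₃ : (P Q R S P′ Q′ R′ S′ : Cube A 0) →
      Λ (node (node (node P Q) (node R S)) (node (node P′ Q′) (node R′ S′))) ≡
      Λ (node (node (node P R) (node Q S)) (node (node P′ R′) (node Q′ S′)))
    Λ-swap₂₃ P Q R S P′ Q′ R′ S′ = E-cong λ x → E-cong λ h₁ → trans (E-swap _)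
      (E-cong λ h₃ → E-cong λ h₂ →
        cong₂ _*_ (prod-swap P Q R S x h₂ h₃ []) (prod-swap P′ Q′ R′ S′ (x ⊕ h₁) h₂ h₃ []))

    -- Fubini moves h₃ outermost. With h₃ fixed, each of the four edges in that direction is a
    -- single function, and the other two directions form a box.
    Λ-box : (P Q R S : Cube A 1) →
      Λ (node (node P Q) (node R S)) ≡ E λ h → box (pair P h) (pair Q h) (pair R h) (pair S h)
    Λ-box P Q R S = trans
      (E-cong λ x → trans (E-cong λ h₁ → E-swap _) (E-swap _))
      (E-swap _)

    -- The U³ form is the average over h of the U² forms of the multiplicative derivatives, each of
    -- which is nonnegative.
    0≤Λ₃ : ∀ c → 0ℚ ≤ Λ (constant 3 c)
    0≤Λ₃ c = subst (0ℚ ≤_) (sym (Λ-box P P P P)) (E-nonneg λ h → 0≤u2 (pair P h))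
      where P = constant 1 c

    -- Three cubes that agree except at one vertex, where the function of the first is the sum of
    -- the other two; the path of constructors names that vertex.
    data Split : ∀ {k} → Cube A k → Cube A k → Cube A k → Set where
      here  : ∀ {c d e} → (∀ x → ev c x ≡ ev d x + ev e x) → Split (leaf c) (leaf d) (leaf e)
      left  : ∀ {k} {F F′ F″ H : Cube A k} → Split F F′ F″ → Split (node F H) (node F′ H) (node F″ H)
      right : ∀ {k} {F F′ F″ H : Cube A k} → Split F F′ F″ → Split (node H F) (node H F′) (node H F″)

    prod-split : ∀ {k} {F F′ F″ : Cube A k} → Split F F′ F″ → ∀ x h → prod F x h ≡ prod F′ x h + prod F″ x h
    prod-split (here eq) x [] = eq x
    prod-split (left {F′ = F′} {F″} {H} s) x (h ∷ hs) = trans (cong (_* prod H (x ⊕ h) hs) (prod-split s x hs))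
      (ℚₚ.*-distribʳ-+ (prod H (x ⊕ h) hs) (prod F′ x hs) (prod F″ x hs))
    prod-split (right {F′ = F′} {F″} {H} s) x (h ∷ hs) = trans (cong (prod H x hs *_) (prod-split s (x ⊕ h) hs))
      (ℚₚ.*-distribˡ-+ (prod H x hs) (prod F′ (x ⊕ h) hs) (prod F″ (x ⊕ h) hs))

    Λ-split : ∀ {k} {F F′ F″ : Cube A k} → Split F F′ F″ → Λ F ≡ Λ F′ + Λ F″
    Λ-split {k} s = trans (E-cong λ x → trans (Eᵛ-cong k (prod-split s x)) (Eᵛ-+ k _ _)) (E-+ _ _)

  -- Replacing g by a or f, one vertex at a time.

  data Label : Set where
    total : Label
    part  : Bool → Label

  module Expansion (a : ℚ) (f g : G → ℚ) (g≡a+f : ∀ x → g x ≡ a + f x) {K δ : ℚ} (0≤K : 0ℚ ≤ K) (0≤δ : 0ℚ ≤ δ)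
    (a≤K : ∣ a ∣ ≤ K) (f≤K : ∀ x → ∣ f x ∣ ≤ K) (g≤K : ∀ x → ∣ g x ∣ ≤ K)
    (u2f : u2 f ≤ (δ * δ) * (δ * δ)) where

    ev : Label → G → ℚ
    ev total        x = g x
    ev (part false) x = a
    ev (part true)  x = f x

    open CubeMean ev public
    open Bounds (0≤square K)

    ev≤K : ∀ c x → ∣ ev c x ∣ ≤ K
    ev≤K total        x = g≤K x
    ev≤K (part false) x = a≤K
    ev≤K (part true)  x = f≤K x

    pair-bounded : ∀ P h → Bounded (pair P h)
    pair-bounded (node (leaf c) (leaf d)) h x = ∣*∣≤ {ev c x} {ev d (x ⊕ h)} (ev≤K c x) (ev≤K d (x ⊕ h))

    -- An edge with the constant at one end and f at the other; `b` says which is at the lower end,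
    -- so both expansions share one argument.
    mixed : Bool → Cube Label 1
    mixed b = node (leaf (part b)) (leaf (part (not b)))

    -- Both values of a pair carry a factor a. For `false` the function is also translated by h, and
    -- `E-shift` removes the translation.
    mixed-corr : ∀ b h d → corr (pair (mixed b) h) (pair (mixed b) h) d ≡ (a * a) * corr f f d
    mixed-corr false h d = trans
      (E-cong λ x → trans (cong (λ z → (a * f (x ⊕ h)) * (a * f z)) (⊕-swapʳ x d h))
        (solve 3 (λ a u v → (a :* u) :* (a :* v) := (a :* a) :* (u :* v)) refl a (f (x ⊕ h)) (f ((x ⊕ h) ⊕ d))))
      (trans (E-* (a * a) (λ x → f (x ⊕ h) * f ((x ⊕ h) ⊕ d)))
        (cong ((a * a) *_) (E-shift (λ y → f y * f (y ⊕ d)) h)))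
    mixed-corr true h d = trans
      (E-cong λ x → solve 3 (λ a u v → (u :* a) :* (v :* a) := (a :* a) :* (u :* v)) refl a (f x) (f (x ⊕ d)))
      (E-* (a * a) (λ x → f x * f (x ⊕ d)))

    -- |a| ≤ K and the U² norm of f is at most δ, so a translate of f times a has U² norm at most
    -- Kδ.
    m = K * δ
    0≤m : 0ℚ ≤ m
    0≤m = 0≤* 0≤K 0≤δ

    mixed-small : ∀ b h → Small m (pair (mixed b) h)
    mixed-small b h = subst (_≤ (m * m) * (m * m))
      (sym (u2-scale a {f} {pair (mixed b) h} (mixed-corr b h)))
      (ℚₚ.≤-trans (*-mono-≤ (0≤u2 f) (0≤square (K * K)) a⁴≤K⁴ u2f)
        (ℚₚ.≤-reflexive (solve 2 (λ K δ → ((K :* K) :* (K :* K)) :* ((δ :* δ) :* (δ :* δ))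
          := ((K :* δ) :* (K :* δ)) :* ((K :* δ) :* (K :* δ))) refl K δ)))
      where
      a² : ∣ a * a ∣ ≤ K * K
      a² = ∣*∣≤ {a} {a} a≤K a≤K
      a⁴≤K⁴ : (a * a) * (a * a) ≤ (K * K) * (K * K)
      a⁴≤K⁴ = ∣∣≤⇒≤ (∣*∣≤ {a * a} {a * a} a² a²)

    -- A pair is a product of two functions bounded by K; hence β = Kδ · (K²)³ = K⁷δ.
    M = K * K
    β = m * (M * (M * M))

    record Negligible (F : Cube Label 3) : Set where
      constructor negligible
      field ∣Λ∣≤ : ∣ Λ F ∣ ≤ β
    open Negligible

    record Near (s : ℚ) (F F′ : Cube Label 3) : Set where
      constructor near
      field ∣Λ-Λ∣≤ : ∣ Λ F - Λ F′ ∣ ≤ s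
    open Near

    -- The mixed edge lies in direction h₃; the subscripts give its position in directions h₁ and
    -- h₂.
    data MixedEdge₃ : Cube Label 3 → Set where
      at₀₀ : ∀ b {Q R S} → MixedEdge₃ (node (node (mixed b) Q) (node R S))
      at₀₁ : ∀ b {P R S} → MixedEdge₃ (node (node P (mixed b)) (node R S))
      at₁₀ : ∀ b {P Q S} → MixedEdge₃ (node (node P Q) (node (mixed b) S))
      at₁₁ : ∀ b {P Q R} → MixedEdge₃ (node (node P Q) (node R (mixed b)))

    mixedEdge₃-negligible : ∀ {F} → MixedEdge₃ F → Negligible F
    mixedEdge₃-negligible {node (node P Q) (node R S)} e =
      negligible (subst (λ z → ∣ z ∣ ≤ β) (sym (Λ-box P Q R S)) (E-∣∣≤ (box-≤ e)))
      where
      ⟦_⟧ = pair-bounded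
      box-≤ : MixedEdge₃ (node (node P Q) (node R S)) → ∀ h → ∣ box (pair P h) (pair Q h) (pair R h) (pair S h) ∣ ≤ β
      box-≤ (at₀₀ b) h = box-smallˡ {m} {pair P h} {pair Q h} {pair R h} {pair S h} 0≤m
        (energy-smallˡ {m} {pair P h} {pair Q h} (mixed-small b h) (⟦ Q ⟧ h)) (⟦ R ⟧ h) (⟦ S ⟧ h)
      box-≤ (at₀₁ b) h = box-smallˡ {m} {pair P h} {pair Q h} {pair R h} {pair S h} 0≤m
        (energy-smallʳ {m} {pair P h} {pair Q h} (⟦ P ⟧ h) (mixed-small b h)) (⟦ R ⟧ h) (⟦ S ⟧ h)
      box-≤ (at₁₀ b) h = box-smallʳ {m} {pair P h} {pair Q h} {pair R h} {pair S h} 0≤m (⟦ P ⟧ h) (⟦ Q ⟧ h)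
        (energy-smallˡ {m} {pair R h} {pair S h} (mixed-small b h) (⟦ S ⟧ h))
      box-≤ (at₁₁ b) h = box-smallʳ {m} {pair P h} {pair Q h} {pair R h} {pair S h} 0≤m (⟦ P ⟧ h) (⟦ Q ⟧ h)
        (energy-smallʳ {m} {pair R h} {pair S h} (⟦ R ⟧ h) (mixed-small b h))

    cube : (c₀₀₀ c₀₀₁ c₀₁₀ c₀₁₁ c₁₀₀ c₁₀₁ c₁₁₀ c₁₁₁ : Label) → Cube Label 3
    cube c₀₀₀ c₀₀₁ c₀₁₀ c₀₁₁ c₁₀₀ c₁₀₁ c₁₁₀ c₁₁₁ =
      node (node (node (leaf c₀₀₀) (leaf c₀₀₁)) (node (leaf c₀₁₀) (leaf c₀₁₁)))
           (node (node (leaf c₁₀₀) (leaf c₁₀₁)) (node (leaf c₁₁₀) (leaf c₁₁₁)))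

    -- Exchanging h₂ and h₃ preserves Λ and turns a mixed edge in direction h₂ into one in direction
    -- h₃.
    swap₂₃-negligible : ∀ {c₀ c₁ c₂ c₃ c₄ c₅ c₆ c₇} → MixedEdge₃ (cube c₀ c₂ c₁ c₃ c₄ c₆ c₅ c₇) →
      Negligible (cube c₀ c₁ c₂ c₃ c₄ c₅ c₆ c₇)
    swap₂₃-negligible {c₀} {c₁} {c₂} {c₃} {c₄} {c₅} {c₆} {c₇} e = negligible (subst (λ z → ∣ z ∣ ≤ β)
      (sym (Λ-swap₂₃ (leaf c₀) (leaf c₁) (leaf c₂) (leaf c₃) (leaf c₄) (leaf c₅) (leaf c₆) (leaf c₇)))
      (∣Λ∣≤ (mixedEdge₃-negligible e)))

    -- A mixed edge in direction h₁ is carried to h₃ by exchanging h₁ with h₂ and then h₂ with h₃,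
    -- so the labels undergo a cyclic permutation of the directions.
    swap₁₃-negligible : ∀ {c₀ c₁ c₂ c₃ c₄ c₅ c₆ c₇} → MixedEdge₃ (cube c₀ c₄ c₁ c₅ c₂ c₆ c₃ c₇) →
      Negligible (cube c₀ c₁ c₂ c₃ c₄ c₅ c₆ c₇)
    swap₁₃-negligible {c₀} {c₁} {c₂} {c₃} {c₄} {c₅} {c₆} {c₇} e = negligible (subst (λ z → ∣ z ∣ ≤ β)
      (sym (Λ-swap₁₂ (node (leaf c₀) (leaf c₁)) (node (leaf c₂) (leaf c₃)) (node (leaf c₄) (leaf c₅)) (node (leaf c₆) (leaf c₇))))
      (∣Λ∣≤ (swap₂₃-negligible e)))

    split : ∀ b → Split (leaf total) (leaf (part b)) (leaf (part (not b)))
    split false = here g≡a+f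
    split true  = here λ x → trans (g≡a+f x) (ℚₚ.+-comm a (f x))

    step : ∀ {F F′ F″} → Split F F′ F″ → Negligible F″ → Near β F F′
    step {F} {F′} {F″} s h = near (subst (λ z → ∣ z ∣ ≤ β)
      (trans (solve 2 (λ u v → v := (u :+ v) :- u) refl (Λ F′) (Λ F″)) (cong (_- Λ F′) (sym (Λ-split s))))
      (∣Λ∣≤ h))

    infixr 4 _▸_
    _▸_ : ∀ {F F′ F″ s t} → Near s F F′ → Near t F′ F″ → Near (s + t) F F″
    _▸_ {F} {F′} {F″} (near p) (near q) = near (∣-∣-trans {Λ F} {Λ F′} {Λ F″} p q)

    7β = β + (β + (β + (β + (β + (β + β)))))

    first : Bool → Cube Label 3
    first b = cube (part b) total total total total total total total

    -- Each vertex is adjacent to one that has already been replaced, so the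
    -- discarded term has a mixed edge.
    replace-all : ∀ b → Near 7β (first b) (constant 3 (part b))
    replace-all b =
        step (left (left (right s)))    (mixedEdge₃-negligible (at₀₀ b))
      ▸ step (left (right (left s)))    (swap₂₃-negligible (at₀₀ b))
      ▸ step (left (right (right s)))   (mixedEdge₃-negligible (at₀₁ b))
      ▸ step (right (left (left s)))    (swap₁₃-negligible (at₀₀ b))
      ▸ step (right (left (right s)))   (mixedEdge₃-negligible (at₁₀ b))
      ▸ step (right (right (left s)))   (swap₂₃-negligible (at₁₀ b))
      ▸ step (right (right (right s)))  (mixedEdge₃-negligible (at₁₁ b))
      where
      s = split b

    -- Splitting vertex 000 is exact and leaves two cubes, one starting with a and one with f. Each
    -- reaches its constant cube after seven more vertices, whence twice `7β`.
    expansion : ∣ Λ (constant 3 total) - (Λ (constant 3 (part false)) + Λ (constant 3 (part true))) ∣ ≤ 7β + 7β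
    expansion = subst (λ z → ∣ z ∣ ≤ 7β + 7β)
      (trans
        (solve 4 (λ u v u′ v′ → (u :- u′) :+ (v :- v′) := (u :+ v) :- (u′ :+ v′)) refl
          (Λ (first false)) (Λ (first true)) (Λ (constant 3 (part false))) (Λ (constant 3 (part true))))
        (cong (_- (Λ (constant 3 (part false)) + Λ (constant 3 (part true))))
          (sym (Λ-split {F = constant 3 total} {first false} {first true} (left (left (left (split false))))))))
      (∣+∣≤ {Λ (first false) - Λ (constant 3 (part false))} {Λ (first true) - Λ (constant 3 (part true))}
        (∣Λ-Λ∣≤ (replace-all false)) (∣Λ-Λ∣≤ (replace-all true)))

    Λ-a : Λ (constant 3 (part false)) ≡ a * (a * (a * (a * (a * (a * (a * (a * 1ℚ)))))))
    Λ-a = trans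
      (trans (E-cong λ x → trans (E-cong λ h₁ → trans (E-cong λ h₂ → E-const _) (E-const _)) (E-const _)) (E-const _))
      (solve 1 (λ a → ((a :* a) :* (a :* a)) :* ((a :* a) :* (a :* a))
        := a :* (a :* (a :* (a :* (a :* (a :* (a :* (a :* con 1ℚ)))))))) refl a)

-- Uniform averages over lists

module ListMeans where
  open import Data.Rational.Base using (_+_; _*_; _≤_)

  natℚ : ℕ → ℚ
  natℚ zero    = 0ℚ
  natℚ (suc n) = 1ℚ + natℚ n

  natℚ-+ : ∀ m n → natℚ (m ℕ.+ n) ≡ natℚ m + natℚ n
  natℚ-+ zero    n = sym (ℚₚ.+-identityˡ (natℚ n))
  natℚ-+ (suc m) n = trans (cong (1ℚ +_) (natℚ-+ m n)) (sym (ℚₚ.+-assoc 1ℚ (natℚ m) (natℚ n)))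

  natℚ-* : ∀ m n → natℚ (m ℕ.* n) ≡ natℚ m * natℚ n
  natℚ-* zero    n = sym (ℚₚ.*-zeroˡ (natℚ n))
  natℚ-* (suc m) n = trans (natℚ-+ n (m ℕ.* n)) (trans (cong (natℚ n +_) (natℚ-* m n))
    (solve 2 (λ m n → n :+ m :* n := (con 1ℚ :+ m) :* n) refl (natℚ m) (natℚ n)))

  toℚᵘ-natℚ : ∀ n → ℚ.toℚᵘ (natℚ n) ℚᵘ.≃ ℚᵘ.mkℚᵘ (ℤ.+ n) 0
  toℚᵘ-natℚ zero    = ℚᵘₚ.≃-refl
  toℚᵘ-natℚ (suc n) = ℚᵘₚ.≃-trans (ℚₚ.toℚᵘ-homo-+ 1ℚ (natℚ n)) (ℚᵘₚ.≃-trans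
    (ℚᵘₚ.+-congʳ (ℚ.toℚᵘ 1ℚ) (toℚᵘ-natℚ n))
    (ℚᵘ.*≡* (cong (λ z → (ℤ.+ 1 ℤ.+ z) ℤ.* ℤ.+ 1) (ℤₚ.*-identityʳ (ℤ.+ n)))))

  recipℚ : ℕ → ℚ
  recipℚ zero    = 0ℚ
  recipℚ (suc n) = ℤ.+ 1 ℚ./ suc n

  recipℚ-inverse : ∀ n → recipℚ (suc n) * natℚ (suc n) ≡ 1ℚ
  recipℚ-inverse n = ℚₚ.toℚᵘ-injective (ℚᵘₚ.≃-trans (ℚₚ.toℚᵘ-homo-* (recipℚ (suc n)) (natℚ (suc n)))
    (ℚᵘₚ.≃-trans (ℚᵘₚ.*-cong (ℚₚ.toℚᵘ-fromℚᵘ (ℚᵘ.mkℚᵘ (ℤ.+ 1) n)) (toℚᵘ-natℚ (suc n)))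
      (ℚᵘ.*≡* (trans (ℤₚ.*-identityʳ _) (trans (ℤₚ.*-identityˡ (ℤ.+ suc n))
        (sym (trans (ℤₚ.*-identityˡ _) (cong ℤ.+_ (ℕₚ.*-identityʳ (suc n))))))))))

  0≤recipℚ : ∀ n → 0ℚ ≤ recipℚ n
  0≤recipℚ zero    = ℚₚ.≤-refl
  0≤recipℚ (suc n) = ℚₚ.nonNegative⁻¹ (recipℚ (suc n)) {{ℚₚ.normalize-nonNeg 1 (suc n)}}

  -- The value 0 at 0 makes this hold for all m and n; otherwise both inverse laws are inserted and
  -- the one for m·n is cancelled.
  recipℚ-* : ∀ m n → recipℚ (m ℕ.* n) ≡ recipℚ m * recipℚ n
  recipℚ-* zero    n = sym (ℚₚ.*-zeroˡ (recipℚ n))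
  recipℚ-* (suc m) zero = trans (cong recipℚ (ℕₚ.*-zeroʳ m)) (sym (ℚₚ.*-zeroʳ (recipℚ (suc m))))
  recipℚ-* m@(suc m-1) n@(suc n-1) = begin
    recipℚ (m ℕ.* n)
      ≡⟨ sym (ℚₚ.*-identityʳ _) ⟩
    recipℚ (m ℕ.* n) * (1ℚ * 1ℚ)
      ≡⟨ cong (recipℚ (m ℕ.* n) *_) (sym (cong₂ _*_ (recipℚ-inverse m-1) (recipℚ-inverse n-1))) ⟩
    recipℚ (m ℕ.* n) * ((recipℚ m * natℚ m) * (recipℚ n * natℚ n))
      ≡⟨ solve 5 (λ x a b c d → x :* ((a :* b) :* (c :* d)) := (x :* (b :* d)) :* (a :* c)) refl
           (recipℚ (m ℕ.* n)) (recipℚ m) (natℚ m) (recipℚ n) (natℚ n) ⟩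
    (recipℚ (m ℕ.* n) * (natℚ m * natℚ n)) * (recipℚ m * recipℚ n)
      ≡⟨ cong (λ z → (recipℚ (m ℕ.* n) * z) * (recipℚ m * recipℚ n)) (sym (natℚ-* m n)) ⟩
    (recipℚ (m ℕ.* n) * natℚ (m ℕ.* n)) * (recipℚ m * recipℚ n)
      -- `n-1 ℕ.+ m-1 ℕ.* n` is the predecessor of `m ℕ.* n`.
      ≡⟨ cong (_* (recipℚ m * recipℚ n)) (recipℚ-inverse (n-1 ℕ.+ m-1 ℕ.* n)) ⟩
    1ℚ * (recipℚ m * recipℚ n)
      ≡⟨ ℚₚ.*-identityˡ _ ⟩
    recipℚ m * recipℚ n ∎
    where open ≡-Reasoning

  private variable
    A B C : Set

  ∑ℚ ∏ℚ : List A → (A → ℚ) → ℚ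
  ∑ℚ xs F = List.foldr _+_ 0ℚ (List.map F xs)
  ∏ℚ xs F = List.foldr _*_ 1ℚ (List.map F xs)

  ∑ℚ-cong : ∀ (xs : List A) {F H} → (∀ x → F x ≡ H x) → ∑ℚ xs F ≡ ∑ℚ xs H
  ∑ℚ-cong xs eq = cong (List.foldr _+_ 0ℚ) (Listₚ.map-cong eq xs)

  ∑ℚ-+ : ∀ (xs : List A) F H → ∑ℚ xs (λ x → F x + H x) ≡ ∑ℚ xs F + ∑ℚ xs H
  ∑ℚ-+ []       F H = sym (ℚₚ.+-identityʳ 0ℚ)
  ∑ℚ-+ (x ∷ xs) F H = trans (cong ((F x + H x) +_) (∑ℚ-+ xs F H))
    (solve 4 (λ a b c d → (a :+ b) :+ (c :+ d) := (a :+ c) :+ (b :+ d)) refl (F x) (H x) (∑ℚ xs F) (∑ℚ xs H))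

  ∑ℚ-* : ∀ (xs : List A) c F → ∑ℚ xs (λ x → c * F x) ≡ c * ∑ℚ xs F
  ∑ℚ-* []       c F = sym (ℚₚ.*-zeroʳ c)
  ∑ℚ-* (x ∷ xs) c F = trans (cong (c * F x +_) (∑ℚ-* xs c F)) (sym (ℚₚ.*-distribˡ-+ c (F x) (∑ℚ xs F)))

  ∑ℚ-mono : ∀ (xs : List A) {F H} → (∀ x → F x ≤ H x) → ∑ℚ xs F ≤ ∑ℚ xs H
  ∑ℚ-mono []       le = ℚₚ.≤-refl
  ∑ℚ-mono (x ∷ xs) le = ℚₚ.+-mono-≤ (le x) (∑ℚ-mono xs le)

  ∑ℚ-const : ∀ (xs : List A) c → ∑ℚ xs (λ _ → c) ≡ natℚ (length xs) * c
  ∑ℚ-const []       c = sym (ℚₚ.*-zeroˡ c)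
  ∑ℚ-const (x ∷ xs) c = trans (cong (c +_) (∑ℚ-const xs c))
    (solve 2 (λ m c → c :+ m :* c := (con 1ℚ :+ m) :* c) refl (natℚ (length xs)) c)

  ∑ℚ-swap : ∀ (xs : List A) (ys : List B) (F : A → B → ℚ) → ∑ℚ xs (λ x → ∑ℚ ys (F x)) ≡ ∑ℚ ys (λ y → ∑ℚ xs (λ x → F x y))
  ∑ℚ-swap []       ys F = sym (trans (∑ℚ-const ys 0ℚ) (ℚₚ.*-zeroʳ (natℚ (length ys))))
  ∑ℚ-swap (x ∷ xs) ys F = trans (cong (∑ℚ ys (F x) +_) (∑ℚ-swap xs ys F)) (sym (∑ℚ-+ ys (F x) (λ y → ∑ℚ xs (λ x → F x y))))

  ∑ℚ-++ : ∀ (xs ys : List A) F → ∑ℚ (xs ++ ys) F ≡ ∑ℚ xs F + ∑ℚ ys F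
  ∑ℚ-++ []       ys F = sym (ℚₚ.+-identityˡ (∑ℚ ys F))
  ∑ℚ-++ (x ∷ xs) ys F = trans (cong (F x +_) (∑ℚ-++ xs ys F)) (sym (ℚₚ.+-assoc (F x) (∑ℚ xs F) (∑ℚ ys F)))

  ∏ℚ-++ : ∀ (xs ys : List A) F → ∏ℚ (xs ++ ys) F ≡ ∏ℚ xs F * ∏ℚ ys F
  ∏ℚ-++ []       ys F = sym (ℚₚ.*-identityˡ (∏ℚ ys F))
  ∏ℚ-++ (x ∷ xs) ys F = trans (cong (F x *_) (∏ℚ-++ xs ys F)) (sym (ℚₚ.*-assoc (F x) (∏ℚ xs F) (∏ℚ ys F)))

  ∏ℚ-map : ∀ (g : A → B) xs F → ∏ℚ (List.map g xs) F ≡ ∏ℚ xs (F ∘ g)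
  ∏ℚ-map g xs F = cong (List.foldr _*_ 1ℚ) (sym (Listₚ.map-∘ xs))

  ∑ℚ-product : ∀ (_∙_ : A → B → C) xs ys F →
    ∑ℚ (cartesianProductWith _∙_ xs ys) F ≡ ∑ℚ xs (λ x → ∑ℚ ys (λ y → F (x ∙ y)))
  ∑ℚ-product _∙_ []       ys F = refl
  ∑ℚ-product _∙_ (x ∷ xs) ys F = trans (∑ℚ-++ (List.map (x ∙_) ys) _ F)
    (cong₂ _+_ (cong (List.foldr _+_ 0ℚ) (sym (Listₚ.map-∘ ys))) (∑ℚ-product _∙_ xs ys F))

  avg : List A → (A → ℚ) → ℚ
  avg xs F = recipℚ (length xs) * ∑ℚ xs F

  avg-cong : ∀ (xs : List A) {F H} → (∀ x → F x ≡ H x) → avg xs F ≡ avg xs H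
  avg-cong xs eq = cong (recipℚ (length xs) *_) (∑ℚ-cong xs eq)

  avg-const-∷ : ∀ (x : A) xs c → avg (x ∷ xs) (λ _ → c) ≡ c
  avg-const-∷ x xs c = begin
    r * ∑ℚ (x ∷ xs) (λ _ → c)       ≡⟨ cong (r *_) (∑ℚ-const (x ∷ xs) c) ⟩
    r * (natℚ (length (x ∷ xs)) * c) ≡⟨ sym (ℚₚ.*-assoc r (natℚ (length (x ∷ xs))) c) ⟩
    (r * natℚ (length (x ∷ xs))) * c ≡⟨ cong (_* c) (recipℚ-inverse (length xs)) ⟩
    1ℚ * c                          ≡⟨ ℚₚ.*-identityˡ c ⟩
    c                               ∎
    where
    open ≡-Reasoning
    r = recipℚ (length (x ∷ xs))

  -- Averages over enumerated products become iterated averages, since lengths multiply and `recipℚ`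
  -- is multiplicative, also for empty lists.
  avg-product : ∀ (_∙_ : A → B → C) xs ys F →
    avg (cartesianProductWith _∙_ xs ys) F ≡ avg xs (λ x → avg ys (λ y → F (x ∙ y)))
  avg-product _∙_ xs ys F = begin
    recipℚ (length (cartesianProductWith _∙_ xs ys)) * ∑ℚ (cartesianProductWith _∙_ xs ys) F
      ≡⟨ cong₂ _*_ (trans (cong recipℚ (length-product xs)) (recipℚ-* (length xs) (length ys))) (∑ℚ-product _∙_ xs ys F) ⟩
    (r * s) * ∑ℚ xs (λ x → ∑ℚ ys (λ y → F (x ∙ y)))
      ≡⟨ ℚₚ.*-assoc r s _ ⟩
    r * (s * ∑ℚ xs (λ x → ∑ℚ ys (λ y → F (x ∙ y))))
      ≡⟨ cong (r *_) (sym (∑ℚ-* xs s _)) ⟩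
    r * ∑ℚ xs (λ x → s * ∑ℚ ys (λ y → F (x ∙ y))) ∎
    where
    open ≡-Reasoning
    r = recipℚ (length xs)
    s = recipℚ (length ys)
    length-product : ∀ xs → length (cartesianProductWith _∙_ xs ys) ≡ length xs ℕ.* length ys
    length-product []       = refl
    length-product (x ∷ xs) = trans (Listₚ.length-++ (List.map (x ∙_) ys))
      (cong₂ ℕ._+_ (Listₚ.length-map (x ∙_) ys) (length-product xs))

open ListMeans

-- Fourteen terms are discarded, each at most (2K)⁷ d, where 2K bounds a, f and
-- a + f.
factor : ℚ → ℚ
factor K = natℚ 14 ℚ.* (K ℚ.+ K) ^ℚ 7

-- Addition modulo p and translation invariance of the uniform average.

module CyclicGroup (q : ℕ) where
  p = suc q

  toℕ-mod : ∀ m → toℕ (m mod p) ≡ m % p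
  toℕ-mod m = Finₚ.toℕ-fromℕ< (m%n<n m p)

  %-+ˡ : ∀ m n → (m % p ℕ.+ n) % p ≡ (m ℕ.+ n) % p
  %-+ˡ m n = trans (%-distribˡ-+ (m % p) n p)
    (trans (cong (λ z → (z ℕ.+ n % p) % p) (m%n%n≡m%n m p)) (sym (%-distribˡ-+ m n p)))

  toℕ-+ₚ : ∀ (i j : Fin p) → toℕ (i +ₚ j) ≡ (toℕ i ℕ.+ toℕ j) % p
  toℕ-+ₚ i j = toℕ-mod (toℕ i ℕ.+ toℕ j)

  +ₚ-comm : ∀ (i j : Fin p) → i +ₚ j ≡ j +ₚ i
  +ₚ-comm i j = cong (_mod p) (ℕₚ.+-comm (toℕ i) (toℕ j))

  toℕ-+ₚ-+ₚ : ∀ (i j k : Fin p) → toℕ ((i +ₚ j) +ₚ k) ≡ (toℕ i ℕ.+ toℕ j ℕ.+ toℕ k) % p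
  toℕ-+ₚ-+ₚ i j k = trans (toℕ-+ₚ (i +ₚ j) k)
    (trans (cong (λ z → (z ℕ.+ toℕ k) % p) (toℕ-+ₚ i j)) (%-+ˡ (toℕ i ℕ.+ toℕ j) (toℕ k)))

  +ₚ-assoc : ∀ (i j k : Fin p) → (i +ₚ j) +ₚ k ≡ i +ₚ (j +ₚ k)
  +ₚ-assoc i j k = Finₚ.toℕ-injective (begin
    toℕ ((i +ₚ j) +ₚ k)                      ≡⟨ toℕ-+ₚ-+ₚ i j k ⟩
    -- Rotating the sum brings the right-hand side, after commutativity, to the same left-nested
    -- form.
    (toℕ i ℕ.+ toℕ j ℕ.+ toℕ k) % p          ≡⟨ cong (_% p) (trans (ℕₚ.+-assoc (toℕ i) (toℕ j) (toℕ k)) (ℕₚ.+-comm (toℕ i) _)) ⟩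
    (toℕ j ℕ.+ toℕ k ℕ.+ toℕ i) % p          ≡⟨ sym (toℕ-+ₚ-+ₚ j k i) ⟩
    toℕ ((j +ₚ k) +ₚ i)                      ≡⟨ cong toℕ (+ₚ-comm (j +ₚ k) i) ⟩
    toℕ (i +ₚ (j +ₚ k))                      ∎)
    where open ≡-Reasoning

  -- The reduction matters at j = 0, where p ∸ j is p and has to wrap round to 0.
  -ₚ_ : Fin p → Fin p
  -ₚ j = (p ℕ.∸ toℕ j) mod p

  +ₚ-cancelʳ : ∀ (i j : Fin p) → (i +ₚ j) +ₚ (-ₚ j) ≡ i
  +ₚ-cancelʳ i j = Finₚ.toℕ-injective (begin
    toℕ ((i +ₚ j) +ₚ (-ₚ j))                          ≡⟨ cong toℕ (trans (+ₚ-assoc i j (-ₚ j)) (+ₚ-comm i _)) ⟩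
    toℕ ((j +ₚ (-ₚ j)) +ₚ i)                          ≡⟨ toℕ-+ₚ (j +ₚ (-ₚ j)) i ⟩
    (toℕ (j +ₚ (-ₚ j)) ℕ.+ toℕ i) % p                 ≡⟨ cong (λ z → (z ℕ.+ toℕ i) % p) j-j ⟩
    toℕ i % p                                         ≡⟨ m<n⇒m%n≡m (Finₚ.toℕ<n i) ⟩
    toℕ i                                             ∎)
    where
    open ≡-Reasoning
    j-j : toℕ (j +ₚ (-ₚ j)) ≡ 0
    j-j = begin
      toℕ (j +ₚ (-ₚ j))                     ≡⟨ cong toℕ (+ₚ-comm j (-ₚ j)) ⟩
      toℕ ((-ₚ j) +ₚ j)                     ≡⟨ toℕ-+ₚ (-ₚ j) j ⟩
      (toℕ (-ₚ j) ℕ.+ toℕ j) % p            ≡⟨ cong (λ z → (z ℕ.+ toℕ j) % p) (toℕ-mod (p ℕ.∸ toℕ j)) ⟩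
      ((p ℕ.∸ toℕ j) % p ℕ.+ toℕ j) % p     ≡⟨ %-+ˡ (p ℕ.∸ toℕ j) (toℕ j) ⟩
      (p ℕ.∸ toℕ j ℕ.+ toℕ j) % p           ≡⟨ cong (_% p) (ℕₚ.m∸n+n≡m (ℕₚ.<⇒≤ (Finₚ.toℕ<n j))) ⟩
      p % p                                 ≡⟨ n%n≡0 p ⟩
      0                                     ∎

  +ₚ-cancelʳ′ : ∀ (i j : Fin p) → (i +ₚ (-ₚ j)) +ₚ j ≡ i
  +ₚ-cancelʳ′ i j = trans (+ₚ-assoc i (-ₚ j) j) (trans (cong (i +ₚ_) (+ₚ-comm (-ₚ j) j))
    (trans (sym (+ₚ-assoc i j (-ₚ j))) (+ₚ-cancelʳ i j)))

  shift : Fin p → Perm.Permutation p p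
  shift j = Perm.permutation (_+ₚ j) (_+ₚ (-ₚ j)) (λ i → +ₚ-cancelʳ′ i j) (λ i → +ₚ-cancelʳ i j)

  ∑ℚ-tabulate : ∀ {A : Set} {n} (g : Fin n → A) F → ∑ℚ (tabulate g) F ≡ sum ℚₚ.+-0-commutativeMonoid (F ∘ g)
  ∑ℚ-tabulate {n = zero}  g F = refl
  ∑ℚ-tabulate {n = suc n} g F = cong (F (g Fin.zero) ℚ.+_) (∑ℚ-tabulate (g ∘ Fin.suc) F)

  ∑ℚ-allFin-shift : ∀ F j → ∑ℚ (allFin p) (λ i → F (i +ₚ j)) ≡ ∑ℚ (allFin p) F
  ∑ℚ-allFin-shift F j = trans (∑ℚ-tabulate id (λ i → F (i +ₚ j)))
    (trans (sym (sum-permute ℚₚ.+-0-commutativeMonoid F (shift j))) (sym (∑ℚ-tabulate id F)))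

  -- Translation acts coordinatewise: the induction hypothesis removes the shift of the tail, and a
  -- permutation of `Fin p` that of the head.
  ∑ℚ-points-shift : ∀ n F h → ∑ℚ (points p n) (λ x → F (x ⊕ h)) ≡ ∑ℚ (points p n) F
  ∑ℚ-points-shift zero    F []       = refl
  ∑ℚ-points-shift (suc n) F (h ∷ hs) = begin
    ∑ℚ (points p (suc n)) (λ x → F (x ⊕ (h ∷ hs)))
      ≡⟨ ∑ℚ-product _∷_ (allFin p) (points p n) _ ⟩
    ∑ℚ (allFin p) (λ i → ∑ℚ (points p n) λ x → F ((i +ₚ h) ∷ (x ⊕ hs)))
      ≡⟨ ∑ℚ-cong (allFin p) (λ i → ∑ℚ-points-shift n (λ x → F ((i +ₚ h) ∷ x)) hs) ⟩
    ∑ℚ (allFin p) (λ i → ∑ℚ (points p n) λ x → F ((i +ₚ h) ∷ x))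
      ≡⟨ ∑ℚ-allFin-shift (λ i → ∑ℚ (points p n) λ x → F (i ∷ x)) h ⟩
    ∑ℚ (allFin p) (λ i → ∑ℚ (points p n) λ x → F (i ∷ x))
      ≡⟨ sym (∑ℚ-product _∷_ (allFin p) (points p n) F) ⟩
    ∑ℚ (points p (suc n)) F ∎
    where open ≡-Reasoning

  avg-const : ∀ n c → avg (points p n) (λ _ → c) ≡ c
  avg-const zero    c = solve 1 (λ c → con 1ℚ :* (c :+ con 0ℚ) := c) refl c
  avg-const (suc n) c = begin
    avg (points p (suc n)) (λ _ → c)                    ≡⟨ avg-product _∷_ (allFin p) (points p n) (λ _ → c) ⟩
    avg (allFin p) (λ _ → avg (points p n) (λ _ → c))   ≡⟨ avg-cong (allFin p) (λ _ → avg-const n c) ⟩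
    avg (allFin p) (λ _ → c)                            ≡⟨ avg-const-∷ Fin.zero (tabulate {n = q} Fin.suc) c ⟩
    c                                                   ∎
    where open ≡-Reasoning

  pointsMean : ∀ n → Mean (Vec (Fin p) n) _⊕_
  pointsMean n = record
    { E       = avg P
    ; E-cong  = avg-cong P
    ; E-+     = λ F H → trans (cong (r ℚ.*_) (∑ℚ-+ P F H)) (ℚₚ.*-distribˡ-+ r _ _)
    ; E-*     = λ c F → trans (cong (r ℚ.*_) (∑ℚ-* P c F))
        (solve 3 (λ r c s → r :* (c :* s) := c :* (r :* s)) refl r c (∑ℚ P F))
    ; E-mono  = λ le → ℚₚ.*-monoˡ-≤-nonNeg r {{nonNegative (0≤recipℚ (length P))}} (∑ℚ-mono P le)
    ; E-const = avg-const n
    ; E-swap  = λ F → cong (r ℚ.*_) (trans (∑ℚ-* P r _) (trans (cong (r ℚ.*_) (∑ℚ-swap P P F)) (sym (∑ℚ-* P r _))))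
    ; E-shift = λ F h → cong (r ℚ.*_) (∑ℚ-points-shift n F h)
    ; ⊕-assoc = Vecₚ.zipWith-assoc +ₚ-assoc
    ; ⊕-comm  = Vecₚ.zipWith-comm +ₚ-comm
    }
    where
    P = points p n
    r = recipℚ (length P)

  -- Gowers forms of rational functions as cube averages.

  module _ {n : ℕ} where
    open MeanTheory (pointsMean n)

    -- `vecs` lists `false` before `true` in its first coordinate, so its two halves are the two
    -- subtrees of the outer `node`.
    ∏ℚ-vertex : ∀ {A : Set} (ev : A → Vec (Fin p) n → ℚ) c k x h →
      ∏ℚ (vecs (false ∷ true ∷ []) k) (λ ω → ev c (vertex x h ω)) ≡ cubeProduct _⊕_ ev (constant k c) x h
    ∏ℚ-vertex ev c zero    x []       = ℚₚ.*-identityʳ (ev c x)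
    ∏ℚ-vertex ev c (suc k) x (h ∷ hs) = begin
      ∏ℚ (List.map (false ∷_) V ++ (List.map (true ∷_) V ++ [])) F
        ≡⟨ ∏ℚ-++ (List.map (false ∷_) V) _ F ⟩
      ∏ℚ (List.map (false ∷_) V) F ℚ.* ∏ℚ (List.map (true ∷_) V ++ []) F
        ≡⟨ cong₂ ℚ._*_ (∏ℚ-map (false ∷_) V F)
             (trans (cong (λ ys → ∏ℚ ys F) (Listₚ.++-identityʳ (List.map (true ∷_) V))) (∏ℚ-map (true ∷_) V F)) ⟩
      ∏ℚ V (λ ω → ev c (vertex x hs ω)) ℚ.* ∏ℚ V (λ ω → ev c (vertex (x ⊕ h) hs ω))
        ≡⟨ cong₂ ℚ._*_ (∏ℚ-vertex ev c k x hs) (∏ℚ-vertex ev c k (x ⊕ h) hs) ⟩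
      cubeProduct _⊕_ ev (constant (suc k) c) x (h ∷ hs) ∎
      where
      open ≡-Reasoning
      V = vecs (false ∷ true ∷ []) k
      F = λ ω → ev c (vertex x (h ∷ hs) ω)

    avg-vecs : ∀ k F → avg (vecs (points p n) k) F ≡ Eᵛ k F
    avg-vecs zero    F = solve 1 (λ c → con 1ℚ :* (c :+ con 0ℚ) := c) refl (F [])
    avg-vecs (suc k) F = trans (avg-product _∷_ (points p n) (vecs (points p n) k) F)
      (avg-cong (points p n) λ h → avg-vecs k (λ hs → F (h ∷ hs)))

    gowersPowerℚ : ℕ → (Vec (Fin p) n → ℚ) → ℚ
    gowersPowerℚ k f = avg (cartesianProduct (points p n) (vecs (points p n) k)) λ (x , h) →
      ∏ℚ (vecs (false ∷ true ∷ []) k) λ ω → f (vertex x h ω)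

    gowersPowerℚ-Λ : ∀ {A : Set} (ev : A → Vec (Fin p) n → ℚ) k c →
      gowersPowerℚ k (ev c) ≡ CubeMean.Λ ev (constant k c)
    gowersPowerℚ-Λ ev k c = trans (avg-product _,_ (points p n) (vecs (points p n) k) _)
      (avg-cong (points p n) λ x → trans (avg-vecs k _) (Eᵛ-cong k (∏ℚ-vertex ev c k x)))

    gowersPowerℚ-u2 : ∀ f → gowersPowerℚ 2 f ≡ u2 f
    gowersPowerℚ-u2 f = gowersPowerℚ-Λ (λ (_ : ⊤) → f) 2 tt

    0≤gowersPowerℚ₂ : ∀ f → 0ℚ ℚ.≤ gowersPowerℚ 2 f
    0≤gowersPowerℚ₂ f = subst (0ℚ ℚ.≤_) (sym (gowersPowerℚ-u2 f)) (0≤u2 f)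

    0≤gowersPowerℚ₃ : ∀ f → 0ℚ ℚ.≤ gowersPowerℚ 3 f
    0≤gowersPowerℚ₃ f = subst (0ℚ ℚ.≤_) (sym (gowersPowerℚ-Λ (λ (_ : ⊤) → f) 3 tt)) (CubeMean.0≤Λ₃ (λ (_ : ⊤) → f) tt)

    gowersPowerℚ-expansion : ∀ a f g {K d} → (∀ x → g x ≡ a ℚ.+ f x) → 0ℚ ℚ.≤ K → 0ℚ ℚ.≤ d →
      ℚ.∣ a ∣ ℚ.≤ K → (∀ x → ℚ.∣ f x ∣ ℚ.≤ K) → gowersPowerℚ 2 f ℚ.≤ d ^ℚ 4 →
      ℚ.∣ gowersPowerℚ 3 g ℚ.- (a ^ℚ 8 ℚ.+ gowersPowerℚ 3 f) ∣ ℚ.≤ factor K ℚ.* d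
    gowersPowerℚ-expansion a f g {K} {d} g≡a+f 0≤K 0≤d a≤ f≤ gp2≤ = subst₂ ℚ._≤_
      (cong ℚ.∣_∣ (cong₂ ℚ._-_ (sym (gowersPowerℚ-Λ ev 3 total))
        (cong₂ ℚ._+_ Λ-a (sym (gowersPowerℚ-Λ ev 3 (part true))))))
      -- L = 2K is the common bound on a, f and g; each discarded term costs L⁷d.
      (solve 2 (λ L d → let β = (L :* d) :* ((L :* L) :* ((L :* L) :* (L :* L)))
                            7β = β :+ (β :+ (β :+ (β :+ (β :+ (β :+ β))))) in
        7β :+ 7β := (con (natℚ 14) :* (L :* (L :* (L :* (L :* (L :* (L :* (L :* con 1ℚ)))))))) :* d) refl (K ℚ.+ K) d)
      expansion
      where
      K≤K+K : K ℚ.≤ K ℚ.+ K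
      K≤K+K = subst (ℚ._≤ K ℚ.+ K) (ℚₚ.+-identityʳ K) (ℚₚ.+-monoʳ-≤ K 0≤K)
      open Expansion a f g g≡a+f {K ℚ.+ K} {d} (0≤+ 0≤K 0≤K) 0≤d (ℚₚ.≤-trans a≤ K≤K+K) (λ x → ℚₚ.≤-trans (f≤ x) K≤K+K)
        (λ x → subst (λ z → ℚ.∣ z ∣ ℚ.≤ K ℚ.+ K) (sym (g≡a+f x)) (∣+∣≤ {a} {f x} a≤ (f≤ x)))
        (subst₂ ℚ._≤_ (gowersPowerℚ-u2 f)
          (solve 1 (λ d → d :* (d :* (d :* (d :* con 1ℚ))) := (d :* d) :* (d :* d)) refl d) gp2≤)

open import Defs

-- Passage to the reals

0<* : ∀ {a b} → 0ℚ ℚ.< a → 0ℚ ℚ.< b → 0ℚ ℚ.< a ℚ.* b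
0<* {a} {b} 0<a 0<b = ℚₚ.positive⁻¹ (a ℚ.* b) {{ℚₚ.pos*pos⇒pos a {{ℚ.positive 0<a}} b {{ℚ.positive 0<b}}}}

0<+ : ∀ {a b} → 0ℚ ℚ.< a → 0ℚ ℚ.< b → 0ℚ ℚ.< a ℚ.+ b
0<+ {a} {b} 0<a 0<b = subst (ℚ._< a ℚ.+ b) (ℚₚ.+-identityʳ 0ℚ) (ℚₚ.+-mono-< 0<a 0<b)

0<½* : ∀ {e} → 0ℚ ℚ.< e → 0ℚ ℚ.< ½ ℚ.* e
0<½* = 0<* (ℚₚ.positive⁻¹ ½)

half+half : ∀ e → ½ ℚ.* e ℚ.+ ½ ℚ.* e ≡ e
half+half e = solve 1 (λ e → con ½ :* e :+ con ½ :* e := e) refl e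

divide : ∀ {e k} → 0ℚ ℚ.< e → 0ℚ ℚ.< k → ∃[ d ] 0ℚ ℚ.< d × k ℚ.* d ≡ e
divide {e} {k} 0<e 0<k = e ℚ.* ℚ.1/ k , 0<* 0<e (ℚₚ.positive⁻¹ (ℚ.1/ k) {{ℚₚ.1/pos⇒pos k}}) ,
  trans (solve 3 (λ k e i → k :* (e :* i) := e :* (k :* i)) refl k e (ℚ.1/ k))
    (trans (cong (e ℚ.*_) (ℚₚ.*-inverseʳ k)) (ℚₚ.*-identityʳ e))
  where
  instance
    k-pos = ℚ.positive 0<k
    k-nonZero = ℚₚ.pos⇒nonZero k

-- Properties that hold at all large indices.

module EventuallyLemmas where
  map : ∀ {P Q : ℕ → Set} → (∀ n → P n → Q n) → Eventually P → Eventually Q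
  map f (N , p) = N , λ n h → f n (p n h)

  infixr 4 _&_
  _&_ : ∀ {P Q} → Eventually P → Eventually Q → Eventually (λ n → P n × Q n)
  (M , f) & (N , g) = M ℕ.⊔ N , λ n h →
    f n (ℕₚ.≤-trans (ℕₚ.m≤m⊔n M N) h) , g n (ℕₚ.≤-trans (ℕₚ.m≤n⊔m M N) h)

  always : ∀ {P} → (∀ n → P n) → Eventually P
  always p = 0 , λ n _ → p n

  -- Finitely many thresholds have a maximum; thus bounds on the individual values of f hold at all
  -- points from a common index on.
  ∀-Fin : ∀ {p} (P : Fin p → ℕ → Set) → (∀ i → Eventually (P i)) → Eventually (λ n → ∀ i → P i n)
  ∀-Fin {zero}  P h = always λ n ()
  ∀-Fin {suc p} P h = map (λ { n (p₀ , pₛ) Fin.zero → p₀ ; n (p₀ , pₛ) (Fin.suc i) → pₛ i })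
    (h Fin.zero & ∀-Fin (λ i → P (Fin.suc i)) (λ i → h (Fin.suc i)))

  ∀-Vec : ∀ {p} k (P : Vec (Fin p) k → ℕ → Set) → (∀ x → Eventually (P x)) → Eventually (λ n → ∀ x → P x n)
  ∀-Vec zero    P h = map (λ { n p [] → p }) (h [])
  ∀-Vec (suc k) P h = map (λ { n p (i ∷ x) → p i x })
    (∀-Fin (λ i n → ∀ x → P (i ∷ x) n) λ i → ∀-Vec k (λ x → P (i ∷ x)) λ x → h (i ∷ x))

open EventuallyLemmas

bounded : ∀ x → ∃[ K ] 0ℚ ℚ.< K × Eventually (λ n → ℚ.∣ seq x n ∣ ℚ.≤ K)
bounded x with cauchy x 1ℚ (ℚₚ.positive⁻¹ 1ℚ)
... | N , h = 1ℚ ℚ.+ ℚ.∣ seq x N ∣ ,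
  subst (ℚ._< 1ℚ ℚ.+ ℚ.∣ seq x N ∣) (ℚₚ.+-identityʳ 0ℚ) (ℚₚ.+-mono-<-≤ (ℚₚ.positive⁻¹ 1ℚ) (ℚₚ.0≤∣p∣ (seq x N))) ,
  N , λ n N≤n → subst (λ t → ℚ.∣ t ∣ ℚ.≤ 1ℚ ℚ.+ ℚ.∣ seq x N ∣)
    (solve 2 (λ a b → (a :- b) :+ b := a) refl (seq x n) (seq x N))
    (∣+∣≤ {seq x n ℚ.- seq x N} {seq x N} (h n N N≤n ℕₚ.≤-refl) ℚₚ.≤-refl)

-- Equality of reals as a congruence.

≈-refl : ∀ x → x ≈ x
≈-refl x ε 0<ε = always λ n → subst (λ t → ℚ.∣ t ∣ ℚ.≤ ε) (sym (ℚₚ.+-inverseʳ (seq x n))) (ℚₚ.<⇒≤ 0<ε)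

≈-trans : ∀ {x y z} → x ≈ y → y ≈ z → x ≈ z
≈-trans {x} {y} {z} p q ε 0<ε = map
  (λ n (h , k) → subst (ℚ.∣ seq x n ℚ.- seq z n ∣ ℚ.≤_) (half+half ε) (∣-∣-trans {seq x n} {seq y n} {seq z n} h k))
  (p (½ ℚ.* ε) (0<½* 0<ε) & q (½ ℚ.* ε) (0<½* 0<ε))

+-cong : ∀ {x x′ y y′} → x ≈ x′ → y ≈ y′ → x + y ≈ x′ + y′
+-cong {x} {x′} {y} {y′} p q ε 0<ε = map
  (λ n (h , k) → subst₂ (λ s t → ℚ.∣ s ∣ ℚ.≤ t)
    (solve 4 (λ a b c d → (a :- c) :+ (b :- d) := (a :+ b) :- (c :+ d)) refl (seq x n) (seq y n) (seq x′ n) (seq y′ n))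
    (half+half ε) (∣+∣≤ {seq x n ℚ.- seq x′ n} {seq y n ℚ.- seq y′ n} h k))
  (p (½ ℚ.* ε) (0<½* 0<ε) & q (½ ℚ.* ε) (0<½* 0<ε))

*-cong : ∀ {x x′ y y′} → x ≈ x′ → y ≈ y′ → x * y ≈ x′ * y′
*-cong {x} {x′} {y} {y′} p q ε 0<ε = go (bounded x) (bounded y′)
  where
  Bounded : ℝ → Set
  Bounded z = ∃[ K ] 0ℚ ℚ.< K × Eventually (λ n → ℚ.∣ seq z n ∣ ℚ.≤ K)
  go : Bounded x → Bounded y′ →
    Eventually (λ n → ℚ.∣ seq x n ℚ.* seq y n ℚ.- seq x′ n ℚ.* seq y′ n ∣ ℚ.≤ ε)
  go (K , 0<K , bx) (L , 0<L , by′) = map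
    (λ n (hx , hy′ , hp , hq) → subst₂ (λ s t → ℚ.∣ s ∣ ℚ.≤ t)
      (solve 4 (λ a b c d → a :* (b :- d) :+ d :* (a :- c) := a :* b :- c :* d) refl
        (seq x n) (seq y n) (seq x′ n) (seq y′ n))
      (trans (sym (ℚₚ.*-distribʳ-+ δ K L)) (proj₂ (proj₂ quotient)))
      (∣+∣≤ {seq x n ℚ.* (seq y n ℚ.- seq y′ n)} {seq y′ n ℚ.* (seq x n ℚ.- seq x′ n)}
        (∣*∣≤ {seq x n} {seq y n ℚ.- seq y′ n} hx hq)
        (∣*∣≤ {seq y′ n} {seq x n ℚ.- seq x′ n} hy′ hp)))
    (bx & by′ & p δ 0<δ & q δ 0<δ)
    where
    quotient = divide 0<ε (0<+ 0<K 0<L)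
    δ = proj₁ quotient
    0<δ = proj₁ (proj₂ quotient)

∑-cong : ∀ {A : Set} (xs : List A) {F H : A → ℝ} → (∀ x → F x ≈ H x) → ∑ xs F ≈ ∑ xs H
∑-cong []       eq = ≈-refl 0ℝ
∑-cong (x ∷ xs) {F} {H} eq = +-cong {F x} {H x} {∑ xs F} {∑ xs H} (eq x) (∑-cong xs eq)

∏-cong : ∀ {A : Set} (xs : List A) {F H : A → ℝ} → (∀ x → F x ≈ H x) → ∏ xs F ≈ ∏ xs H
∏-cong []       eq = ≈-refl 1ℝ
∏-cong (x ∷ xs) {F} {H} eq = *-cong {F x} {H x} {∏ xs F} {∏ xs H} (eq x) (∏-cong xs eq)

𝔼-cong : ∀ {A : Set} (xs : List A) {F H : A → ℝ} → (∀ x → F x ≈ H x) → 𝔼 xs F ≈ 𝔼 xs H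
𝔼-cong xs {F} {H} eq = *-cong {recip (length xs)} {recip (length xs)} {∑ xs F} {∑ xs H}
  (≈-refl (recip (length xs))) (∑-cong xs eq)

-- The hypothesis on g is an equality of reals, which need not hold index by index; this transfers
-- the Gowers form of g to that of the pointwise sum a + f.
gowersPower-cong : ∀ {p n} k {f g : Vec (Fin p) n → ℝ} → (∀ x → f x ≈ g x) → gowersPower k f ≈ gowersPower k g
gowersPower-cong {p} {n} k {f} {g} eq = 𝔼-cong (cartesianProduct (points p n) (vecs (points p n) k))
  λ (x , h) → ∏-cong (vecs _ k) λ ω → eq (vertex x h ω)

-- Real Gowers powers evaluated at one index.

seq-∑ : ∀ {A : Set} (xs : List A) F N → seq (∑ xs F) N ≡ ∑ℚ xs (λ x → seq (F x) N)
seq-∑ []       F N = refl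
seq-∑ (x ∷ xs) F N = cong (seq (F x) N ℚ.+_) (seq-∑ xs F N)

seq-∏ : ∀ {A : Set} (xs : List A) F N → seq (∏ xs F) N ≡ ∏ℚ xs (λ x → seq (F x) N)
seq-∏ []       F N = refl
seq-∏ (x ∷ xs) F N = cong (seq (F x) N ℚ.*_) (seq-∏ xs F N)

seq-recip : ∀ m N → seq (recip m) N ≡ recipℚ m
seq-recip zero    N = refl
seq-recip (suc m) N = refl

seq-^ : ∀ x d N → seq (x ^ d) N ≡ seq x N ^ℚ d
seq-^ x zero    N = refl
seq-^ x (suc d) N = cong (seq x N ℚ.*_) (seq-^ x d N)

module _ (q : ℕ) (n : ℕ) where
  open CyclicGroup q

  seq-gowersPower : ∀ k (f : Vec (Fin (suc q)) n → ℝ) N → seq (gowersPower k f) N ≡ gowersPowerℚ k (λ x → seq (f x) N)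
  seq-gowersPower k f N = cong₂ ℚ._*_ (seq-recip (length C) N)
    (trans (seq-∑ C _ N) (∑ℚ-cong C λ (x , h) → seq-∏ (vecs _ k) _ N))
    where C = cartesianProduct (points (suc q) n) (vecs (points (suc q) n) k)

  0≤gowersPower : ∀ k → (∀ f → 0ℚ ℚ.≤ gowersPowerℚ {n} k f) → ∀ f → 0ℝ ≤ gowersPower {suc q} {n} k f
  0≤gowersPower k pos f ε 0<ε = always λ N → subst (λ z → 0ℚ ℚ.≤ z ℚ.+ ε) (sym (seq-gowersPower k f N))
    (0≤+ (pos (λ x → seq (f x) N)) (ℚₚ.<⇒≤ 0<ε))

  ‖‖U₂-^ : ∀ (f : Vec (Fin (suc q)) n → ℝ) → (‖ f ‖U 2) ^ 4 ≈ gowersPower 2 f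
  ‖‖U₂-^ f = root-^ (2 ℕ.^ 2) (gowersPower 2 f) (0≤gowersPower 2 0≤gowersPowerℚ₂ f)

  ‖‖U₃-^ : ∀ (f : Vec (Fin (suc q)) n → ℝ) → (‖ f ‖U 3) ^ 8 ≈ gowersPower 3 f
  ‖‖U₃-^ f = root-^ (2 ℕ.^ 3) (gowersPower 3 f) (0≤gowersPower 3 0≤gowersPowerℚ₃ f)

two = 1ℚ ℚ.+ 1ℚ

-- An inequality of reals holds at large indices only up to slack; slack 1 turns the bound 1 into 2.
eventually-∣∣≤2 : ∀ x → - 1ℝ ≤ x × x ≤ 1ℝ → Eventually (λ N → ℚ.∣ seq x N ∣ ℚ.≤ two)
eventually-∣∣≤2 x (l , u) = map
  (λ N (lN , uN) → ≤⇒∣∣≤ (subst ((ℚ.- two) ℚ.≤_) (solve 1 (λ a → (a :+ con 1ℚ) :- con 1ℚ := a) refl (seq x N))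
    (ℚₚ.+-monoˡ-≤ (ℚ.- 1ℚ) lN)) uN)
  (l 1ℚ (ℚₚ.positive⁻¹ 1ℚ) & u 1ℚ (ℚₚ.positive⁻¹ 1ℚ))

0<factor : 0ℚ ℚ.< factor two
0<factor = 0<* (ℚₚ.positive⁻¹ (natℚ 14)) (0<* 0<4 (0<* 0<4 (0<* 0<4 (0<* 0<4 (0<* 0<4 (0<* 0<4 (0<* 0<4 (ℚₚ.positive⁻¹ 1ℚ))))))))
  where
  0<4 : 0ℚ ℚ.< two ℚ.+ two
  0<4 = ℚₚ.positive⁻¹ (two ℚ.+ two)

^4-mono : ∀ {u v} → ℚ.∣ u ∣ ℚ.≤ v → u ^ℚ 4 ℚ.≤ v ^ℚ 4
^4-mono {u} {v} h = ∣∣≤⇒≤ (go 4)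
  where
  go : ∀ k → ℚ.∣ u ^ℚ k ∣ ℚ.≤ v ^ℚ k
  go zero    = ℚₚ.≤-refl
  go (suc k) = ∣*∣≤ {u} {u ^ℚ k} h (go k)

-- G and F stand for powers of roots, G′ and F′ for the Gowers forms they approximate; each
-- replacement costs half of η.
combine : ∀ {G F A G′ F′ b η} → ℚ.∣ G′ ℚ.- (A ℚ.+ F′) ∣ ℚ.≤ b →
  ℚ.∣ G ℚ.- G′ ∣ ℚ.≤ ½ ℚ.* η → ℚ.∣ F ℚ.- F′ ∣ ℚ.≤ ½ ℚ.* η → ℚ.∣ G ℚ.- (A ℚ.+ F) ∣ ℚ.≤ b ℚ.+ η
combine {G} {F} {A} {G′} {F′} {b} {η} main cg cf = subst₂ (λ u v → ℚ.∣ u ∣ ℚ.≤ v)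
  (solve 5 (λ G F A G′ F′ → (G′ :- (A :+ F′)) :+ ((G :- G′) :+ (F′ :- F)) := G :- (A :+ F)) refl G F A G′ F′)
  (cong (b ℚ.+_) (half+half η))
  (∣+∣≤ {G′ ℚ.- (A ℚ.+ F′)} {(G ℚ.- G′) ℚ.+ (F′ ℚ.- F)} main
    (∣+∣≤ {G ℚ.- G′} {F′ ℚ.- F} cg (subst (ℚ._≤ ½ ℚ.* η) (∣-∣-sym F F′) cf)))

-- 15 = 2⁴ − 1.
power-small : ∀ {t r P} → 0ℚ ℚ.≤ r ℚ.+ t → r ℚ.≤ ½ ℚ.* t ℚ.+ ½ ℚ.* t →
  ℚ.∣ r ^ℚ 4 ℚ.- P ∣ ℚ.≤ natℚ 15 ℚ.* t ^ℚ 4 → P ℚ.≤ (two ℚ.* t) ^ℚ 4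
power-small {t} {r} {P} l u c = subst₂ ℚ._≤_
  (solve 2 (λ a b → b :+ (a :- b) := a) refl P (r ^ℚ 4))
  (solve 1 (λ t → t :* (t :* (t :* (t :* con 1ℚ))) :+ con (natℚ 15) :* (t :* (t :* (t :* (t :* con 1ℚ))))
    := (con two :* t) :* ((con two :* t) :* ((con two :* t) :* ((con two :* t) :* con 1ℚ)))) refl t)
  (ℚₚ.+-mono-≤ {r ^ℚ 4} {t ^ℚ 4} (^4-mono {r} {t} (≤⇒∣∣≤ lower (subst (r ℚ.≤_) (half+half t) u)))
    (∣∣≤⇒≤ (subst (ℚ._≤ natℚ 15 ℚ.* t ^ℚ 4) (∣-∣-sym (r ^ℚ 4) P) c)))
  where
  lower : ℚ.- t ℚ.≤ r
  lower = subst₂ ℚ._≤_ (ℚₚ.+-identityˡ (ℚ.- t)) (solve 2 (λ r t → (r :+ t) :- t := r) refl r t)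
    (ℚₚ.+-monoˡ-≤ (ℚ.- t) l)

-- Chooses t so that the total error of the rational expansion, with U² bound 2t, is exactly δ₀.
scale : ∀ {δ₀} → 0ℚ ℚ.< δ₀ → ∃[ t ] 0ℚ ℚ.< t × factor two ℚ.* (two ℚ.* t) ≡ δ₀
scale {δ₀} 0<δ₀ = t , 0<t , trans (sym (ℚₚ.*-assoc (factor two) two t)) eq
  where
  quotient = divide {δ₀} {factor two ℚ.* two} 0<δ₀ (0<* {factor two} {two} 0<factor (ℚₚ.positive⁻¹ two))
  t = proj₁ quotient
  0<t = proj₁ (proj₂ quotient)
  eq : (factor two ℚ.* two) ℚ.* t ≡ δ₀
  eq = proj₂ (proj₂ quotient)

∣-∣≤-intro : ∀ x a y ε b → (∀ η → 0ℚ ℚ.< η → Eventually λ N → ℚ.∣ seq x N ℚ.- (seq a N ℚ.+ seq y N) ∣ ℚ.≤ b ℚ.+ η) →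
  Eventually (λ N → b ℚ.≤ seq ε N) → ∣ x - (a + y) ∣ ≤ ε
∣-∣≤-intro x a y ε b h b≤ε η 0<η = map (λ N (hN , bN) → ℚₚ.≤-trans hN (ℚₚ.+-monoˡ-≤ η bN)) (h η 0<η & b≤ε)

-- Choice of constants and the final estimate.

module Conclusion (q : ℕ) (t : ℚ) (0<t : 0ℚ ℚ.< t) where
  open CyclicGroup q

  δ = two ℚ.* t

  -- Norm bound t/2 with slack t/2, nonnegativity with slack t and the root identity with slack 15t⁴
  -- together give the bound (2t)⁴ at large indices.
  gowersPower₂-small : ∀ n (f : Vec (Fin (suc q)) n → ℝ) → ‖ f ‖U 2 ≤ fromℚ (½ ℚ.* t) →
    Eventually λ N → gowersPowerℚ 2 (λ x → seq (f x) N) ℚ.≤ δ ^ℚ 4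
  gowersPower₂-small n f h = map
    (λ N (l , u , c) → subst (ℚ._≤ δ ^ℚ 4) (seq-gowersPower q n 2 f N)
      (power-small {t} {seq (‖ f ‖U 2) N} {seq (gowersPower 2 f) N} l u
        (subst (λ z → ℚ.∣ z ℚ.- seq (gowersPower 2 f) N ∣ ℚ.≤ natℚ 15 ℚ.* t ^ℚ 4) (seq-^ (‖ f ‖U 2) 4 N) c)))
    (0≤root 4 (gowersPower 2 f) t 0<t & h (½ ℚ.* t) (0<½* 0<t) & ‖‖U₂-^ q n f (natℚ 15 ℚ.* t ^ℚ 4) 0<η)
    where
    0<η : 0ℚ ℚ.< natℚ 15 ℚ.* t ^ℚ 4
    0<η = 0<* (ℚₚ.positive⁻¹ (natℚ 15)) (0<* 0<t (0<* 0<t (0<* 0<t (0<* 0<t (ℚₚ.positive⁻¹ 1ℚ)))))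

  expansion-≤ : ∀ n (f g : Vec (Fin (suc q)) n → ℝ) (a : ℝ) → (∀ x → - 1ℝ ≤ f x × f x ≤ 1ℝ) → ‖ f ‖U 2 ≤ fromℚ (½ ℚ.* t) →
    - 1ℝ ≤ a × a ≤ 1ℝ → (∀ x → g x ≈ a + f x) →
    ∀ η → 0ℚ ℚ.< η → Eventually λ N →
      ℚ.∣ seq ((‖ g ‖U 3) ^ 8) N ℚ.- (seq (a ^ 8) N ℚ.+ seq ((‖ f ‖U 3) ^ 8) N) ∣ ℚ.≤ factor two ℚ.* δ ℚ.+ η
  expansion-≤ n f g a f≤ u2≤ a≤ g≈ η 0<η = map
    (λ N (cg , cf , aN , fN , s) → combine
      {seq ((‖ g ‖U 3) ^ 8) N} {seq ((‖ f ‖U 3) ^ 8) N} {seq (a ^ 8) N}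
      {seq (gowersPower 3 (λ x → a + f x)) N} {seq (gowersPower 3 f) N} {factor two ℚ.* δ} {η}
      (subst₂ (λ u v → ℚ.∣ u ℚ.- (seq (a ^ 8) N ℚ.+ v) ∣ ℚ.≤ factor two ℚ.* δ)
        (sym (seq-gowersPower q n 3 (λ x → a + f x) N)) (sym (seq-gowersPower q n 3 f N))
        (subst (λ z → ℚ.∣ gowersPowerℚ 3 (λ x → seq (a + f x) N) ℚ.- (z ℚ.+ gowersPowerℚ 3 (λ x → seq (f x) N)) ∣
            ℚ.≤ factor two ℚ.* δ)
          (sym (seq-^ a 8 N))
          -- Addition of reals is termwise, so at index N the function a + f is the rational sum by
          -- definition.
          (gowersPowerℚ-expansion (seq a N) (λ x → seq (f x) N) (λ x → seq (a + f x) N) {two} {δ} (λ x → refl)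
            (ℚₚ.nonNegative⁻¹ two) (0≤* (ℚₚ.nonNegative⁻¹ two) (ℚₚ.<⇒≤ 0<t)) aN fN s)))
      cg cf)
    (  ≈-trans {(‖ g ‖U 3) ^ 8} {gowersPower 3 g} {gowersPower 3 (λ x → a + f x)}
         (‖‖U₃-^ q n g) (gowersPower-cong 3 {g} {λ x → a + f x} g≈) (½ ℚ.* η) (0<½* 0<η)
     & ‖‖U₃-^ q n f (½ ℚ.* η) (0<½* 0<η)
     & eventually-∣∣≤2 a a≤
     & ∀-Vec n (λ x N → ℚ.∣ seq (f x) N ∣ ℚ.≤ two) (λ x → eventually-∣∣≤2 (f x) (f≤ x))
     & gowersPower₂-small n f u2≤)

  conclusion : ∀ ε → Eventually (λ N → factor two ℚ.* δ ℚ.≤ seq ε N) →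
    ∃[ c ] 0ℝ < c ×
    ((n : ℕ) (f g : Vec (Fin (suc q)) n → ℝ) (a : ℝ) →
    (∀ x → - 1ℝ ≤ f x × f x ≤ 1ℝ) →
    ‖ f ‖U 2 ≤ c →
    - 1ℝ ≤ a × a ≤ 1ℝ →
    (∀ x → g x ≈ a + f x) →
    ∣ (‖ g ‖U 3) ^ 8 - (a ^ 8 + (‖ f ‖U 3) ^ 8) ∣ ≤ ε)
  conclusion ε b = fromℚ (½ ℚ.* t) ,
    -- The constant c = t/2 is itself the gap that witnesses 0 < c.
    (½ ℚ.* t , 0<½* 0<t , always λ N → ℚₚ.≤-reflexive (ℚₚ.+-identityˡ (½ ℚ.* t))) ,
    λ n f g a f≤ u2≤ a≤ g≈ → ∣-∣≤-intro ((‖ g ‖U 3) ^ 8) (a ^ 8) ((‖ f ‖U 3) ^ 8) ε (factor two ℚ.* δ)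
      (expansion-≤ n f g a f≤ u2≤ a≤ g≈) b

theorem4p1 : (p : ℕ) → Prime p → 2 ∤ p →
    (ε : ℝ) → 0ℝ < ε →
    ∃[ c ] 0ℝ < c ×
    ((n : ℕ) (f g : Vec (Fin p) n → ℝ) (a : ℝ) →
    (∀ x → - 1ℝ ≤ f x × f x ≤ 1ℝ) →
    ‖ f ‖U 2 ≤ c →
    - 1ℝ ≤ a × a ≤ 1ℝ →
    (∀ x → g x ≈ a + f x) →
    ∣ (‖ g ‖U 3) ^ 8 - (a ^ 8 + (‖ f ‖U 3) ^ 8) ∣ ≤ ε)
theorem4p1 zero    pr = contradiction pr ¬prime[0]
-- Positivity of ε supplies a rational δ₀ > 0 eventually below it, which becomes the error to be
-- met.
theorem4p1 (suc q) _ _ ε (δ₀ , 0<δ₀ , δ₀≤ε) = Conclusion.conclusion q t 0<t ε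
  (map (λ N → subst (ℚ._≤ seq ε N) (trans (ℚₚ.+-identityˡ δ₀) (sym eq))) δ₀≤ε)
  where
  t = proj₁ (scale 0<δ₀)
  0<t = proj₁ (proj₂ (scale 0<δ₀))
  eq : factor two ℚ.* (two ℚ.* t) ≡ δ₀
  eq = proj₂ (proj₂ (scale 0<δ₀))
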